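{- Let $\mu_m=\dfrac{(aq;q)_m}{(abq^2;q)_m}$ for integers $m\ge 0$. Let $n$ be a positive integer and let $k_0,\dots,k_{n-1}$ be nonnegative integers. Then $$\det\left(\mu_{k_i+j}\right)_{0\le i,j\le n-1}=a^{\binom n2}\,q^{\binom{n+1}3}\prod_{i=0}^{n-1}\frac{(aq;q)_{k_i}}{(abq^2;q)_{k_i+n-1}}\prod_{0\le i<j\le n-1}\left(q^{k_i}-q^{k_j}\right)\prod_{i=0}^{n-1}(bq;q)_i.$$
   Context: Here $a,b,q$ are indeterminates, and the identity is an identity of rational functions in $a,b,q$. For a nonnegative integer $m$, the $q$-shifted factorial is $(x;q)_m=\prod_{k=0}^{m-1}(1-xq^k)$, with $(x;q)_0=1$. -}

module Defs where

open import Algebra.Bundles using (CommutativeRing; Semiring)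
import Algebra.Definitions.RawMonoid as RawMonoidDefs
import Algebra.Definitions.RawSemiring as RawSemiringDefs
import Algebra.Properties.CommutativeSemigroup as CommutativeSemigroupProperties
import Algebra.Properties.Ring as RingProperties
import Algebra.Solver.Ring.NaturalCoefficients.Default as SemiringSolver
open import Data.Bool.Base using (if_then_else_)
open import Data.Fin.Base using (Fin; zero; suc; toℕ)
open import Data.Fin.Properties using (_<?_)
open import Data.List.Base using (List; []; _∷_; map)
open import Data.Nat.Base using (ℕ; zero; suc)
open import Data.Product.Base using (_,_)
open import Data.Rational.Base as ℚ using (ℚ; 0ℚ)
import Data.Rational.Properties as ℚ
open import Data.Sum.Base using (_⊎_; inj₁; inj₂; map₁)
open import Data.Vec.Functional using (Vector; removeAt)
open import Level using (0ℓ; _⊔_) renaming (suc to lsuc)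
open import Relation.Binary.Bundles using (Setoid)
open import Relation.Binary.PropositionalEquality as ≡ using (_≡_)
import Relation.Binary.Reasoning.Setoid as SetoidReasoning
open import Relation.Nullary using (¬_; Dec; yes; no; does; contradiction)

------------------------------------------------------------------------
-- Determinants, finite products and q-shifted factorials

module CommutativeRingDefs {c ℓ} (R : CommutativeRing c ℓ) where
  open CommutativeRing R hiding (zero)
  open RawSemiringDefs (Semiring.rawSemiring semiring) public using (_^_)
  open RawMonoidDefs +-rawMonoid public using () renaming (sum to ∑)
  open RawMonoidDefs *-rawMonoid public using () renaming (sum to ∏)

  Matrix : ℕ → Set c
  Matrix n = Vector (Vector Carrier n) n

  -- Laplace expansion along the first row.
  det : ∀ {n} → Matrix n → Carrier
  det {zero}  M = 1#
  det {suc n} M =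
    ∑ λ j → (- 1#) ^ toℕ j * M zero j * det (λ i → removeAt (M (suc i)) j)

  -- The product of f i j over all pairs i < j.
  ∏< : ∀ {n} → (Fin n → Fin n → Carrier) → Carrier
  ∏< f = ∏ λ i → ∏ λ j → if does (i <? j) then f i j else 1#

  -- The q-shifted factorial (x;q)ₘ.
  ⟨_⨾_⟩_ : Carrier → Carrier → ℕ → Carrier
  ⟨ x ⨾ q ⟩ m = ∏ {m} λ k → 1# - x * q ^ toℕ k

------------------------------------------------------------------------
-- Integral domains with a decidable test for zero

record IntegralDomain c ℓ : Set (lsuc (c ⊔ ℓ)) where
  field
    commutativeRing : CommutativeRing c ℓ
  open CommutativeRing commutativeRing public
  field
    _≟0   : ∀ x → Dec (x ≈ 0#)
    1≉0   : 1# ≉ 0#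
    xy≈0⇒ : ∀ {x y} → x * y ≈ 0# → x ≈ 0# ⊎ y ≈ 0#

  xy≉0 : ∀ {x y} → x ≉ 0# → y ≉ 0# → x * y ≉ 0#
  xy≉0 x≉0 y≉0 xy≈0 with xy≈0⇒ xy≈0
  ... | inj₁ x≈0 = x≉0 x≈0
  ... | inj₂ y≈0 = y≉0 y≈0

------------------------------------------------------------------------
-- Univariate polynomials over a commutative ring

-- A polynomial is a list of coefficients, constant term first; trailing
-- zeros are allowed, and equality compares all coefficients.
module Polynomial {c ℓ} (R : CommutativeRing c ℓ) where
  private module R = CommutativeRing R
  open R using (Carrier; _≈_; 0#; 1#)
  open RingProperties R.ring using (-0#≈0#)
  open CommutativeSemigroupProperties R.+-commutativeSemigroup using (interchange)

  Poly : Set c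
  Poly = List Carrier

  coeff : Poly → ℕ → Carrier
  coeff []      _       = 0#
  coeff (x ∷ p) zero    = x
  coeff (x ∷ p) (suc n) = coeff p n

  infix 4 _≈ₚ_
  record _≈ₚ_ (p r : Poly) : Set ℓ where
    constructor mk≈
    field coeff≈ : ∀ n → coeff p n ≈ coeff r n
  open _≈ₚ_ public

  infixl 6 _+ₚ_
  infixl 7 _*ₚ_ _·_

  _+ₚ_ : Poly → Poly → Poly
  []      +ₚ r       = r
  (x ∷ p) +ₚ []      = x ∷ p
  (x ∷ p) +ₚ (y ∷ r) = x R.+ y ∷ p +ₚ r

  -ₚ_ : Poly → Poly
  -ₚ p = map (λ x → R.- x) p

  _·_ : Carrier → Poly → Poly
  x · p = map (x R.*_) p

  _*ₚ_ : Poly → Poly → Poly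
  []      *ₚ r = []
  (x ∷ p) *ₚ r = x · r +ₚ (0# ∷ p *ₚ r)

  0ₚ 1ₚ X : Poly
  0ₚ = []
  1ₚ = 1# ∷ []
  X  = 0# ∷ 1# ∷ []

  const : Carrier → Poly
  const x = x ∷ []

  setoid : Setoid c ℓ
  setoid = record
    { Carrier       = Poly
    ; _≈_           = _≈ₚ_
    ; isEquivalence = record
      { refl  = mk≈ λ _ → R.refl
      ; sym   = λ e → mk≈ λ n → R.sym (coeff≈ e n)
      ; trans = λ e f → mk≈ λ n → R.trans (coeff≈ e n) (coeff≈ f n)
      }
    }
  open Setoid setoid using () renaming (refl to ≈-refl; sym to ≈-sym; trans to ≈-trans)

  coeff-+ : ∀ p r n → coeff (p +ₚ r) n ≈ coeff p n R.+ coeff r n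
  coeff-+ []      r       n       = R.sym (R.+-identityˡ _)
  coeff-+ (x ∷ p) []      n       = R.sym (R.+-identityʳ _)
  coeff-+ (x ∷ p) (y ∷ r) zero    = R.refl
  coeff-+ (x ∷ p) (y ∷ r) (suc n) = coeff-+ p r n

  coeff-neg : ∀ p n → coeff (-ₚ p) n ≈ R.- coeff p n
  coeff-neg []      n       = R.sym -0#≈0#
  coeff-neg (x ∷ p) zero    = R.refl
  coeff-neg (x ∷ p) (suc n) = coeff-neg p n

  coeff-· : ∀ x p n → coeff (x · p) n ≈ x R.* coeff p n
  coeff-· x []      n       = R.sym (R.zeroʳ x)
  coeff-· x (y ∷ p) zero    = R.refl
  coeff-· x (y ∷ p) (suc n) = coeff-· x p n

  ∷-cong : ∀ {x y p r} → x ≈ y → p ≈ₚ r → x ∷ p ≈ₚ y ∷ r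
  ∷-cong e f = mk≈ λ { zero → e ; (suc n) → coeff≈ f n }

  tail≈ : ∀ {x y p r} → x ∷ p ≈ₚ y ∷ r → p ≈ₚ r
  tail≈ e = mk≈ λ n → coeff≈ e (suc n)

  0∷[]≈[] : 0# ∷ [] ≈ₚ []
  0∷[]≈[] = mk≈ λ { zero → R.refl ; (suc n) → R.refl }

  +-cong : ∀ {p p′ r r′} → p ≈ₚ p′ → r ≈ₚ r′ → p +ₚ r ≈ₚ p′ +ₚ r′
  +-cong {p} {p′} {r} {r′} e f = mk≈ λ n → R.trans (coeff-+ p r n)
    (R.trans (R.+-cong (coeff≈ e n) (coeff≈ f n)) (R.sym (coeff-+ p′ r′ n)))

  +-assoc : ∀ p r s → (p +ₚ r) +ₚ s ≈ₚ p +ₚ (r +ₚ s)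
  +-assoc p r s = mk≈ λ n → begin
    coeff ((p +ₚ r) +ₚ s) n                   ≈⟨ coeff-+ (p +ₚ r) s n ⟩
    coeff (p +ₚ r) n R.+ coeff s n            ≈⟨ R.+-congʳ (coeff-+ p r n) ⟩
    coeff p n R.+ coeff r n R.+ coeff s n     ≈⟨ R.+-assoc _ _ _ ⟩
    coeff p n R.+ (coeff r n R.+ coeff s n)   ≈⟨ R.+-congˡ (coeff-+ r s n) ⟨
    coeff p n R.+ coeff (r +ₚ s) n            ≈⟨ coeff-+ p (r +ₚ s) n ⟨
    coeff (p +ₚ (r +ₚ s)) n                   ∎
    where open SetoidReasoning R.setoid

  +-comm : ∀ p r → p +ₚ r ≈ₚ r +ₚ p
  +-comm p r = mk≈ λ n → R.trans (coeff-+ p r n)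
    (R.trans (R.+-comm _ _) (R.sym (coeff-+ r p n)))

  +-identityʳ : ∀ p → p +ₚ [] ≈ₚ p
  +-identityʳ p = +-comm p []

  -‿cong : ∀ {p r} → p ≈ₚ r → -ₚ p ≈ₚ -ₚ r
  -‿cong {p} {r} e = mk≈ λ n → R.trans (coeff-neg p n)
    (R.trans (R.-‿cong (coeff≈ e n)) (R.sym (coeff-neg r n)))

  -‿inverseʳ : ∀ p → p +ₚ (-ₚ p) ≈ₚ []
  -‿inverseʳ p = mk≈ λ n → R.trans (coeff-+ p (-ₚ p) n)
    (R.trans (R.+-congˡ (coeff-neg p n)) (R.-‿inverseʳ _))

  -‿inverseˡ : ∀ p → (-ₚ p) +ₚ p ≈ₚ []
  -‿inverseˡ p = ≈-trans (+-comm (-ₚ p) p) (-‿inverseʳ p)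

  +-interchange : ∀ p r s t → (p +ₚ r) +ₚ (s +ₚ t) ≈ₚ (p +ₚ s) +ₚ (r +ₚ t)
  +-interchange p r s t = mk≈ λ n → begin
    coeff ((p +ₚ r) +ₚ (s +ₚ t)) n  ≈⟨ expand p r s t n ⟩
    (coeff p n R.+ coeff r n) R.+ (coeff s n R.+ coeff t n) ≈⟨ interchange _ _ _ _ ⟩
    (coeff p n R.+ coeff s n) R.+ (coeff r n R.+ coeff t n) ≈⟨ expand p s r t n ⟨
    coeff ((p +ₚ s) +ₚ (r +ₚ t)) n  ∎
    where
    open SetoidReasoning R.setoid
    expand : ∀ p r s t n → coeff ((p +ₚ r) +ₚ (s +ₚ t)) n
      ≈ (coeff p n R.+ coeff r n) R.+ (coeff s n R.+ coeff t n)
    expand p r s t n = R.trans (coeff-+ (p +ₚ r) (s +ₚ t) n)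
      (R.+-cong (coeff-+ p r n) (coeff-+ s t n))

  ·-cong : ∀ {x y p r} → x ≈ y → p ≈ₚ r → x · p ≈ₚ y · r
  ·-cong {x} {y} {p} {r} e f = mk≈ λ n → R.trans (coeff-· x p n)
    (R.trans (R.*-cong e (coeff≈ f n)) (R.sym (coeff-· y r n)))

  ·-distribˡ : ∀ x p r → x · (p +ₚ r) ≈ₚ x · p +ₚ x · r
  ·-distribˡ x p r = mk≈ λ n → begin
    coeff (x · (p +ₚ r)) n                        ≈⟨ coeff-· x (p +ₚ r) n ⟩
    x R.* coeff (p +ₚ r) n                        ≈⟨ R.*-congˡ (coeff-+ p r n) ⟩
    x R.* (coeff p n R.+ coeff r n)               ≈⟨ R.distribˡ _ _ _ ⟩
    x R.* coeff p n R.+ x R.* coeff r n           ≈⟨ R.+-cong (coeff-· x p n) (coeff-· x r n) ⟨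
    coeff (x · p) n R.+ coeff (x · r) n           ≈⟨ coeff-+ (x · p) (x · r) n ⟨
    coeff (x · p +ₚ x · r) n                      ∎
    where open SetoidReasoning R.setoid

  ·-assoc : ∀ x y p → (x R.* y) · p ≈ₚ x · (y · p)
  ·-assoc x y p = mk≈ λ n → begin
    coeff ((x R.* y) · p) n    ≈⟨ coeff-· (x R.* y) p n ⟩
    x R.* y R.* coeff p n      ≈⟨ R.*-assoc _ _ _ ⟩
    x R.* (y R.* coeff p n)    ≈⟨ R.*-congˡ (coeff-· y p n) ⟨
    x R.* coeff (y · p) n      ≈⟨ coeff-· x (y · p) n ⟨
    coeff (x · (y · p)) n      ∎
    where open SetoidReasoning R.setoid

  0·p≈[] : ∀ p → 0# · p ≈ₚ []
  0·p≈[] p = mk≈ λ n → R.trans (coeff-· 0# p n) (R.zeroˡ _)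

  1·p≈p : ∀ p → 1# · p ≈ₚ p
  1·p≈p p = mk≈ λ n → R.trans (coeff-· 1# p n) (R.*-identityˡ _)

  shift-+ : ∀ p r → 0# ∷ (p +ₚ r) ≈ₚ (0# ∷ p) +ₚ (0# ∷ r)
  shift-+ p r = ∷-cong (R.sym (R.+-identityˡ 0#)) ≈-refl

  *-congˡ : ∀ p {r s} → r ≈ₚ s → p *ₚ r ≈ₚ p *ₚ s
  *-congˡ []      e = ≈-refl
  *-congˡ (x ∷ p) e = +-cong (·-cong R.refl e) (∷-cong R.refl (*-congˡ p e))

  *-zeroʳ : ∀ p → p *ₚ [] ≈ₚ []
  *-zeroʳ []      = ≈-refl
  *-zeroʳ (x ∷ p) = ≈-trans (∷-cong R.refl (*-zeroʳ p)) 0∷[]≈[]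

  *-∷ʳ : ∀ p y r → p *ₚ (y ∷ r) ≈ₚ y · p +ₚ (0# ∷ p *ₚ r)
  *-∷ʳ []      y r = ≈-sym 0∷[]≈[]
  *-∷ʳ (x ∷ p) y r = ∷-cong (R.+-congʳ (R.*-comm x y)) (begin
    x · r +ₚ p *ₚ (y ∷ r)                ≈⟨ +-cong ≈-refl (*-∷ʳ p y r) ⟩
    x · r +ₚ (y · p +ₚ (0# ∷ p *ₚ r))    ≈⟨ +-assoc (x · r) (y · p) _ ⟨
    x · r +ₚ y · p +ₚ (0# ∷ p *ₚ r)      ≈⟨ +-cong (+-comm (x · r) (y · p)) ≈-refl ⟩
    y · p +ₚ x · r +ₚ (0# ∷ p *ₚ r)      ≈⟨ +-assoc (y · p) (x · r) _ ⟩
    y · p +ₚ (x · r +ₚ (0# ∷ p *ₚ r))    ∎)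
    where open SetoidReasoning setoid

  *-comm : ∀ p r → p *ₚ r ≈ₚ r *ₚ p
  *-comm []      r = ≈-sym (*-zeroʳ r)
  *-comm (x ∷ p) r =
    ≈-trans (+-cong ≈-refl (∷-cong R.refl (*-comm p r))) (≈-sym (*-∷ʳ r x p))

  *-cong : ∀ {p p′ r r′} → p ≈ₚ p′ → r ≈ₚ r′ → p *ₚ r ≈ₚ p′ *ₚ r′
  *-cong {p} {p′} {r} {r′} e f = ≈-trans (*-congˡ p f)
    (≈-trans (*-comm p r′) (≈-trans (*-congˡ r′ e) (*-comm r′ p′)))

  *-distribˡ : ∀ p r s → p *ₚ (r +ₚ s) ≈ₚ p *ₚ r +ₚ p *ₚ s
  *-distribˡ []      r s = ≈-refl
  *-distribˡ (x ∷ p) r s = begin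
    x · (r +ₚ s) +ₚ (0# ∷ p *ₚ (r +ₚ s))
      ≈⟨ +-cong (·-distribˡ x r s)
           (≈-trans (∷-cong R.refl (*-distribˡ p r s)) (shift-+ (p *ₚ r) (p *ₚ s))) ⟩
    (x · r +ₚ x · s) +ₚ ((0# ∷ p *ₚ r) +ₚ (0# ∷ p *ₚ s))
      ≈⟨ +-interchange (x · r) (x · s) _ _ ⟩
    (x · r +ₚ (0# ∷ p *ₚ r)) +ₚ (x · s +ₚ (0# ∷ p *ₚ s)) ∎
    where open SetoidReasoning setoid

  *-distribʳ : ∀ s p r → (p +ₚ r) *ₚ s ≈ₚ p *ₚ s +ₚ r *ₚ s
  *-distribʳ s p r = ≈-trans (*-comm (p +ₚ r) s)
    (≈-trans (*-distribˡ s p r) (+-cong (*-comm s p) (*-comm s r)))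

  ·-*-assoc : ∀ x p r → (x · p) *ₚ r ≈ₚ x · (p *ₚ r)
  ·-*-assoc x []      r = ≈-refl
  ·-*-assoc x (y ∷ p) r = begin
    (x R.* y) · r +ₚ (0# ∷ (x · p) *ₚ r)
      ≈⟨ +-cong (·-assoc x y r) (∷-cong (R.sym (R.zeroʳ x)) (·-*-assoc x p r)) ⟩
    x · (y · r) +ₚ x · (0# ∷ p *ₚ r)
      ≈⟨ ·-distribˡ x (y · r) _ ⟨
    x · (y · r +ₚ (0# ∷ p *ₚ r)) ∎
    where open SetoidReasoning setoid

  shift-* : ∀ p r → (0# ∷ p) *ₚ r ≈ₚ 0# ∷ p *ₚ r
  shift-* p r = +-cong (0·p≈[] r) ≈-refl

  *-assoc : ∀ p r s → (p *ₚ r) *ₚ s ≈ₚ p *ₚ (r *ₚ s)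
  *-assoc []      r s = ≈-refl
  *-assoc (x ∷ p) r s = begin
    (x · r +ₚ (0# ∷ p *ₚ r)) *ₚ s          ≈⟨ *-distribʳ s (x · r) _ ⟩
    (x · r) *ₚ s +ₚ (0# ∷ p *ₚ r) *ₚ s     ≈⟨ +-cong (·-*-assoc x r s) (shift-* (p *ₚ r) s) ⟩
    x · (r *ₚ s) +ₚ (0# ∷ (p *ₚ r) *ₚ s)   ≈⟨ +-cong ≈-refl (∷-cong R.refl (*-assoc p r s)) ⟩
    x · (r *ₚ s) +ₚ (0# ∷ p *ₚ (r *ₚ s))   ∎
    where open SetoidReasoning setoid

  *-identityˡ : ∀ p → 1ₚ *ₚ p ≈ₚ p
  *-identityˡ p = ≈-trans (+-cong (1·p≈p p) 0∷[]≈[]) (+-identityʳ p)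

  commutativeRing : CommutativeRing c ℓ
  commutativeRing = record
    { Carrier = Poly
    ; _≈_     = _≈ₚ_
    ; _+_     = _+ₚ_
    ; _*_     = _*ₚ_
    ; -_      = -ₚ_
    ; 0#      = 0ₚ
    ; 1#      = 1ₚ
    ; isCommutativeRing = record
      { isRing = record
        { +-isAbelianGroup = record
          { isGroup = record
            { isMonoid = record
              { isSemigroup = record
                { isMagma = record
                  { isEquivalence = Setoid.isEquivalence setoid
                  ; ∙-cong        = +-cong
                  }
                ; assoc = +-assoc
                }
              ; identity = (λ _ → ≈-refl) , +-identityʳ
              }
            ; inverse = -‿inverseˡ , -‿inverseʳ
            ; ⁻¹-cong = -‿cong
            }
          ; comm = +-comm
          }
        ; *-cong     = *-cong
        ; *-assoc    = *-assoc
        ; *-identity = *-identityˡ , λ p → ≈-trans (*-comm p 1ₚ) (*-identityˡ p)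
        ; distrib    = *-distribˡ , *-distribʳ
        }
      ; *-comm = *-comm
      }
    }

infix 9 _[X]
_[X] : ∀ {c ℓ} → IntegralDomain c ℓ → IntegralDomain c ℓ
D [X] = record
  { commutativeRing = commutativeRing
  ; _≟0             = _≟0
  ; 1≉0             = λ e → D.1≉0 (coeff≈ e 0)
  ; xy≈0⇒           = λ {p} {r} → noZeroDivisors p r
  }
  where
  module D = IntegralDomain D
  open D using (_≈_; 0#)
  open Polynomial D.commutativeRing

  ∷≈[] : ∀ {x p} → x ≈ 0# → p ≈ₚ [] → x ∷ p ≈ₚ []
  ∷≈[] e f = mk≈ λ { zero → e ; (suc n) → coeff≈ f n }

  tail≈[] : ∀ {x p} → x ∷ p ≈ₚ [] → p ≈ₚ []
  tail≈[] e = mk≈ λ n → coeff≈ e (suc n)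

  _≟0 : ∀ p → Dec (p ≈ₚ [])
  []      ≟0 = yes (mk≈ λ _ → D.refl)
  (x ∷ p) ≟0 with x D.≟0 | p ≟0
  ... | yes e | yes f = yes (∷≈[] e f)
  ... | yes e | no ¬f = no λ g → ¬f (tail≈[] g)
  ... | no ¬e | _     = no λ g → ¬e (coeff≈ g 0)

  open Setoid setoid using () renaming (refl to ≈-refl; sym to ≈-sym; trans to ≈-trans)

  nonzeroHead : ∀ {x} p r → ¬ x ≈ 0# → (x ∷ p) *ₚ r ≈ₚ [] → r ≈ₚ []
  nonzeroHead     p []      x≉0 e = ≈-refl
  nonzeroHead {x} p (y ∷ r) x≉0 e = ∷≈[] y≈0 (nonzeroHead p r x≉0 (tail≈[] {0#}
    (≈-trans (≈-sym (≈-trans (*-∷ʳ (x ∷ p) y r)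
      (+-cong (≈-trans (·-cong y≈0 ≈-refl) (0·p≈[] (x ∷ p))) ≈-refl))) e)))
    where
    y≈0 : y ≈ 0#
    y≈0 with D.xy≈0⇒ (D.trans (D.sym (D.+-identityʳ _)) (coeff≈ e 0))
    ... | inj₁ x≈0 = contradiction x≈0 x≉0
    ... | inj₂ y≈0 = y≈0

  noZeroDivisors : ∀ p r → p *ₚ r ≈ₚ [] → p ≈ₚ [] ⊎ r ≈ₚ []
  noZeroDivisors []      r e = inj₁ ≈-refl
  noZeroDivisors (x ∷ p) r e with x D.≟0
  ... | yes x≈0 = map₁ (∷≈[] x≈0)
    (noZeroDivisors p r (tail≈[] {0#} (≈-trans (≈-sym (shift-* p r))
      (≈-trans (*-cong (∷-cong (D.sym x≈0) (≈-refl {p})) ≈-refl) e))))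
  ... | no x≉0 = inj₂ (nonzeroHead p r x≉0 e)

------------------------------------------------------------------------
-- The field of fractions

module Fractions {c ℓ} (D : IntegralDomain c ℓ) where
  open IntegralDomain D
  open SemiringSolver commutativeSemiring using (solve; _:+_; _:*_; _:=_)
  open RingProperties ring using (x∙y⁻¹≈ε⇒x≈y; [y-z]x≈yx-zx; -‿distribˡ-*)

  record Frac : Set (c ⊔ ℓ) where
    constructor frac
    field
      num   : Carrier
      den   : Carrier
      den≉0 : den ≉ 0#
  open Frac public

  infix 4 _≈ᶠ_
  record _≈ᶠ_ (x y : Frac) : Set ℓ where
    constructor mk≈
    field cross≈ : num x * den y ≈ num y * den x
  open _≈ᶠ_ public

  infixl 6 _+ᶠ_
  infixl 7 _*ᶠ_
  infix  8 -ᶠ_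
  infix  9 _⁻¹

  _+ᶠ_ _*ᶠ_ : Frac → Frac → Frac
  x +ᶠ y = frac (num x * den y + num y * den x) (den x * den y) (xy≉0 (den≉0 x) (den≉0 y))
  x *ᶠ y = frac (num x * num y) (den x * den y) (xy≉0 (den≉0 x) (den≉0 y))

  -ᶠ_ : Frac → Frac
  -ᶠ x = frac (- num x) (den x) (den≉0 x)

  embed : Carrier → Frac
  embed x = frac x 1# 1≉0

  0ᶠ 1ᶠ : Frac
  0ᶠ = embed 0#
  1ᶠ = embed 1#

  -- The inverse is total, with 0ᶠ ⁻¹ = 0ᶠ.
  _⁻¹ : Frac → Frac
  x ⁻¹ with num x ≟0
  ... | yes _      = 0ᶠ
  ... | no  num≉0  = frac (den x) (num x) num≉0

  *-cancelʳ : ∀ {x y z} → z ≉ 0# → x * z ≈ y * z → x ≈ y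
  *-cancelʳ {x} {y} {z} z≉0 e with xy≈0⇒ {x - y} {z} eq
    where
    open SetoidReasoning setoid
    eq : (x - y) * z ≈ 0#
    eq = begin
      (x - y) * z     ≈⟨ [y-z]x≈yx-zx z x y ⟩
      x * z - y * z   ≈⟨ +-congʳ e ⟩
      y * z - y * z   ≈⟨ -‿inverseʳ _ ⟩
      0#              ∎
  ... | inj₁ x-y≈0 = x∙y⁻¹≈ε⇒x≈y x y x-y≈0
  ... | inj₂ z≈0   = contradiction z≈0 z≉0

  ≈-refl : ∀ {x} → x ≈ᶠ x
  ≈-refl = mk≈ refl

  ≈-sym : ∀ {x y} → x ≈ᶠ y → y ≈ᶠ x
  ≈-sym e = mk≈ (sym (cross≈ e))

  ≈-trans : ∀ {x y z} → x ≈ᶠ y → y ≈ᶠ z → x ≈ᶠ z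
  ≈-trans {frac a b _} {frac c d d≉0} {frac e f _} (mk≈ ad≈cb) (mk≈ cf≈ed) =
    mk≈ (*-cancelʳ d≉0 (begin
      a * f * d   ≈⟨ solve 3 (λ a f d → a :* f :* d := a :* d :* f) refl a f d ⟩
      a * d * f   ≈⟨ *-congʳ ad≈cb ⟩
      c * b * f   ≈⟨ solve 3 (λ c b f → c :* b :* f := c :* f :* b) refl c b f ⟩
      c * f * b   ≈⟨ *-congʳ cf≈ed ⟩
      e * d * b   ≈⟨ solve 3 (λ e d b → e :* d :* b := e :* b :* d) refl e d b ⟩
      e * b * d   ∎))
    where open SetoidReasoning setoid

  +ᶠ-cong : ∀ {x x′ y y′} → x ≈ᶠ x′ → y ≈ᶠ y′ → x +ᶠ y ≈ᶠ x′ +ᶠ y′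
  +ᶠ-cong {frac a b _} {frac a′ b′ _} {frac c d _} {frac c′ d′ _} (mk≈ e) (mk≈ f) = mk≈ (begin
    (a * d + c * b) * (b′ * d′)
      ≈⟨ solve 6 (λ a b c d b′ d′ → (a :* d :+ c :* b) :* (b′ :* d′)
           := (a :* b′) :* (d :* d′) :+ (c :* d′) :* (b :* b′)) refl a b c d b′ d′ ⟩
    (a * b′) * (d * d′) + (c * d′) * (b * b′)
      ≈⟨ +-cong (*-congʳ e) (*-congʳ f) ⟩
    (a′ * b) * (d * d′) + (c′ * d) * (b * b′)
      ≈⟨ solve 6 (λ a′ b′ c′ d′ b d → (a′ :* b) :* (d :* d′) :+ (c′ :* d) :* (b :* b′)
           := (a′ :* d′ :+ c′ :* b′) :* (b :* d)) refl a′ b′ c′ d′ b d ⟩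
    (a′ * d′ + c′ * b′) * (b * d) ∎)
    where
    open SetoidReasoning setoid

  *ᶠ-cong : ∀ {x x′ y y′} → x ≈ᶠ x′ → y ≈ᶠ y′ → x *ᶠ y ≈ᶠ x′ *ᶠ y′
  *ᶠ-cong {frac a b _} {frac a′ b′ _} {frac c d _} {frac c′ d′ _} (mk≈ e) (mk≈ f) = mk≈ (begin
    (a * c) * (b′ * d′)   ≈⟨ swap a c b′ d′ ⟩
    (a * b′) * (c * d′)   ≈⟨ *-cong e f ⟩
    (a′ * b) * (c′ * d)   ≈⟨ swap a′ b c′ d ⟩
    (a′ * c′) * (b * d)   ∎)
    where
    open SetoidReasoning setoid
    swap : ∀ a c b d → (a * c) * (b * d) ≈ (a * b) * (c * d)
    swap = solve 4 (λ a c b d → (a :* c) :* (b :* d) := (a :* b) :* (c :* d)) refl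

  -- fractionField is a field: see *-inverseʳ below.
  fractionField : CommutativeRing (c ⊔ ℓ) ℓ
  fractionField = record
    { Carrier = Frac
    ; _≈_     = _≈ᶠ_
    ; _+_     = _+ᶠ_
    ; _*_     = _*ᶠ_
    ; -_      = -ᶠ_
    ; 0#      = 0ᶠ
    ; 1#      = 1ᶠ
    ; isCommutativeRing = record
      { isRing = record
        { +-isAbelianGroup = record
          { isGroup = record
            { isMonoid = record
              { isSemigroup = record
                { isMagma = record
                  { isEquivalence = record
                    { refl  = ≈-refl
                    ; sym   = ≈-sym
                    ; trans = ≈-trans
                    }
                  ; ∙-cong        = +ᶠ-cong
                  }
                ; assoc = λ { (frac a b _) (frac c d _) (frac e f _) → mk≈
                    (solve 6 (λ a b c d e f →
                      ((a :* d :+ c :* b) :* f :+ e :* (b :* d)) :* (b :* (d :* f)) :=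
                      (a :* (d :* f) :+ (c :* f :+ e :* d) :* b) :* ((b :* d) :* f))
                      refl a b c d e f) }
                }
              ; identity = (λ { (frac a b _) → mk≈ (identity+ˡ a b) })
                         , (λ { (frac a b _) → mk≈ (identity+ʳ a b) })
              }
            ; inverse = (λ { (frac a b _) → mk≈ (inverseˡ a b) })
                      , (λ { (frac a b _) → mk≈ (inverseʳ a b) })
            ; ⁻¹-cong = λ { {frac a b _} {frac c d _} (mk≈ e) → mk≈ (neg-cong a b c d e) }
            }
          ; comm = λ { (frac a b _) (frac c d _) → mk≈
              (solve 4 (λ a b c d → (a :* d :+ c :* b) :* (d :* b) := (c :* b :+ a :* d) :* (b :* d))
                refl a b c d) }
          }
        ; *-cong     = *ᶠ-cong
        ; *-assoc    = λ { (frac a b _) (frac c d _) (frac e f _) → mk≈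
            (*-cong (*-assoc a c e) (sym (*-assoc b d f))) }
        ; *-identity = (λ { (frac a b _) → mk≈
                         (*-cong (*-identityˡ a) (sym (*-identityˡ b))) })
                     , (λ { (frac a b _) → mk≈
                         (*-cong (*-identityʳ a) (sym (*-identityʳ b))) })
        ; distrib    = (λ { (frac a b _) (frac c d _) (frac e f _) → mk≈
            (solve 6 (λ a b c d e f →
              (a :* (c :* f :+ e :* d)) :* ((b :* d) :* (b :* f)) :=
              ((a :* c) :* (b :* f) :+ (a :* e) :* (b :* d)) :* (b :* (d :* f)))
              refl a b c d e f) })
                     , (λ { (frac a b _) (frac c d _) (frac e f _) → mk≈
            (solve 6 (λ a b c d e f →
              ((c :* f :+ e :* d) :* a) :* ((d :* b) :* (f :* b)) :=
              ((c :* a) :* (f :* b) :+ (e :* a) :* (d :* b)) :* ((d :* f) :* b))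
              refl a b c d e f) })
        }
      ; *-comm = λ { (frac a b _) (frac c d _) → mk≈ (*-cong (*-comm a c) (*-comm d b)) }
      }
    }
    where
    open SetoidReasoning setoid

    identity+ˡ : ∀ a b → (0# * b + a * 1#) * b ≈ a * (1# * b)
    identity+ˡ a b = *-cong
      (trans (+-cong (zeroˡ b) (*-identityʳ a)) (+-identityˡ a)) (sym (*-identityˡ b))

    identity+ʳ : ∀ a b → (a * 1# + 0# * b) * b ≈ a * (b * 1#)
    identity+ʳ a b = *-cong
      (trans (+-cong (*-identityʳ a) (zeroˡ b)) (+-identityʳ a)) (sym (*-identityʳ b))

    inverseˡ : ∀ a b → (- a * b + a * b) * 1# ≈ 0# * (b * b)
    inverseˡ a b = begin
      (- a * b + a * b) * 1#   ≈⟨ *-identityʳ _ ⟩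
      - a * b + a * b          ≈⟨ distribʳ b (- a) a ⟨
      (- a + a) * b            ≈⟨ *-congʳ (-‿inverseˡ a) ⟩
      0# * b                   ≈⟨ zeroˡ b ⟩
      0#                       ≈⟨ zeroˡ _ ⟨
      0# * (b * b)             ∎

    inverseʳ : ∀ a b → (a * b + - a * b) * 1# ≈ 0# * (b * b)
    inverseʳ a b = trans (*-congʳ (+-comm (a * b) (- a * b))) (inverseˡ a b)

    neg-cong : ∀ a b c d → a * d ≈ c * b → - a * d ≈ - c * b
    neg-cong a b c d e = begin
      - a * d     ≈⟨ -‿distribˡ-* a d ⟨
      - (a * d)   ≈⟨ -‿cong e ⟩
      - (c * b)   ≈⟨ -‿distribˡ-* c b ⟩
      - c * b     ∎

  *-inverseʳ : ∀ x → ¬ (x ≈ᶠ 0ᶠ) → x *ᶠ x ⁻¹ ≈ᶠ 1ᶠ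
  *-inverseʳ x x≉0 with num x ≟0
  ... | yes e = contradiction
    (mk≈ (trans (*-identityʳ _) (trans e (sym (zeroˡ _))))) x≉0
  ... | no _  = mk≈ (trans (*-identityʳ _) (trans (*-comm _ _) (sym (*-identityˡ _))))

  infixl 7 _/_
  _/_ : Frac → Frac → Frac
  x / y = x *ᶠ y ⁻¹

------------------------------------------------------------------------
-- The field ℚ(a, b, q) of rational functions, as the field of fractions
-- of ℚ[a][b][q]

ℚ-domain : IntegralDomain 0ℓ 0ℓ
ℚ-domain = record
  { commutativeRing = ℚ.+-*-commutativeRing
  ; _≟0             = ℚ._≟ 0ℚ
  ; 1≉0             = ℚ.1≢0
  ; xy≈0⇒           = λ {x} {y} → noZeroDivisors x y
  }
  where
  noZeroDivisors : ∀ x y → x ℚ.* y ≡ 0ℚ → x ≡ 0ℚ ⊎ y ≡ 0ℚ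
  noZeroDivisors x y e with x ℚ.≟ 0ℚ
  ... | yes x≡0 = inj₁ x≡0
  ... | no  x≢0 = inj₂ (≡.trans (≡.sym (ℚ.*-identityˡ y))
      (≡.trans (≡.cong (ℚ._* y) (≡.sym (ℚ.*-inverseˡ x)))
      (≡.trans (ℚ.*-assoc (ℚ.1/ x) x y)
      (≡.trans (≡.cong (ℚ.1/ x ℚ.*_) e) (ℚ.*-zeroʳ (ℚ.1/ x))))))
    where instance x-nonZero = ℚ.≢-nonZero x≢0

ℚ[a] ℚ[a,b] ℚ[a,b,q] : IntegralDomain 0ℓ 0ℓ
ℚ[a]     = ℚ-domain [X]
ℚ[a,b]   = ℚ[a] [X]
ℚ[a,b,q] = ℚ[a,b] [X]

private
  module P₁ = Polynomial (IntegralDomain.commutativeRing ℚ-domain)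
  module P₂ = Polynomial (IntegralDomain.commutativeRing ℚ[a])
  module P₃ = Polynomial (IntegralDomain.commutativeRing ℚ[a,b])

open Fractions ℚ[a,b,q] public using (_/_) renaming (fractionField to ℚ⟨a,b,q⟩)
open CommutativeRing ℚ⟨a,b,q⟩ public using (_≈_; _*_; _-_; Carrier)
open CommutativeRingDefs ℚ⟨a,b,q⟩ public

a b q : Carrier
a = Fractions.embed ℚ[a,b,q] (P₃.const (P₂.const P₁.X))
b = Fractions.embed ℚ[a,b,q] (P₃.const P₂.X)
q = Fractions.embed ℚ[a,b,q] P₃.X

-- The denominator is a nonzero rational function: each of its factors
-- 1 - abqⁱ⁺² specializes to 1 at a = 0.
μ : ℕ → Carrier
μ m = ⟨ a * q ⨾ q ⟩ m / ⟨ a * b * q ^ 2 ⨾ q ⟩ m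

{-# OPTIONS --safe #-}
module Submission where

-- Write A t = a q^(1+t), B t = a b q^(2+t) and x i = q^(k i).  Pulling
-- (aq;q)_{k i} / (abq²;q)_{k i + n - 1} out of row i leaves the entries
--   p j (x i),   p j x = ∏_{t<j} (1 - A t x) ∏_{j≤t<n-1} (1 - B t x).
-- The combination (1 - B j y) p (j+1) - (1 - A j y) p j equals
-- (y - x) (A j - B j) p′ j, where p′ is the same family for n - 1 and the
-- shifted sequence B ∘ suc.  With y = x 0, the corresponding column operations
-- clear the first row except for its first entry ∏ (1 - B j (x 0)), which is
-- also the factor by which they scale the determinant and hence cancels.
-- By induction, the determinant is
--   ∏_{i<j} (x i - x j) ∏_{t≤s<n-1} (A t - B s),
-- and A t - B s = a q^(1+t) (1 - b q^(1+s-t)).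

open import Defs using (module CommutativeRingDefs; module Polynomial)
open import Algebra.Bundles using (CommutativeRing)
import Algebra.Properties.CommutativeMonoid.Sum as CommutativeMonoidSum
import Algebra.Properties.Ring as RingProperties
import Algebra.Properties.Semiring.Exp as Exp
import Algebra.Properties.Semiring.Sum as SemiringSum
import Algebra.Solver.Ring.NaturalCoefficients.Default as SemiringSolver
open import Data.Bool.Base using (if_then_else_)
open import Data.Fin.Base using (Fin; zero; suc; toℕ; fromℕ<; punchIn; punchOut)
open import Data.Fin.Properties
  using (_≟_; _<?_; toℕ-fromℕ<; toℕ-injective; toℕ≤pred[n];
    punchInᵢ≢i; punchIn-injective; punchIn-punchOut)
open import Data.List.Base using ([]; _∷_)
open import Data.Nat.Base using (ℕ; zero; suc; NonZero; pred; _+_; _≤_; z≤n; s≤s)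
open import Data.Nat.Combinatorics using (_C_; nC1≡n; nCk+nC[k+1]≡[n+1]C[k+1])
import Data.Nat.Properties as ℕ
open import Data.Product.Base using (∃; _,_; proj₁; proj₂)
open import Data.Rational.Base as ℚ using (ℚ; 0ℚ; 1ℚ)
import Data.Rational.Properties as ℚ
open import Data.Vec.Functional using (Vector; tail; removeAt; updateAt)
open import Data.Vec.Functional.Properties using (updateAt-updates; updateAt-minimal)
open import Function.Base using (_∘_; const)
open import Level using (_⊔_)
open import Relation.Binary.PropositionalEquality as ≡ using (_≡_; _≢_)
import Relation.Binary.Reasoning.Setoid as SetoidReasoning
open import Relation.Nullary using (¬_; yes; no; does; contradiction)

-- Adjacent indices and spliced sequences

-- An inductive form of `toℕ j ≡ suc (toℕ i)`: sums and vectors are traversed by recursion on it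
-- until the pair stands at the front.
data Adjacent : ∀ {n} → Fin n → Fin n → Set where
  here  : ∀ {n} → Adjacent {suc (suc n)} zero (suc zero)
  there : ∀ {n} {i j : Fin n} → Adjacent i j → Adjacent (suc i) (suc j)

toℕ-adjacent : ∀ {n} {i j : Fin n} → Adjacent i j → toℕ j ≡ suc (toℕ i)
toℕ-adjacent here        = ≡.refl
toℕ-adjacent (there i∼j) = ≡.cong suc (toℕ-adjacent i∼j)

adjacent : ∀ {n} (i j : Fin n) → toℕ j ≡ suc (toℕ i) → Adjacent i j
adjacent zero    (suc zero) e = here
adjacent (suc i) (suc j)    e = there (adjacent i j (ℕ.suc-injective e))

adjacent-≢ : ∀ {n} {i j : Fin n} → Adjacent i j → i ≢ j
adjacent-≢ i∼j ≡.refl = ℕ.1+n≢n (≡.sym (toℕ-adjacent i∼j))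

-- No index lies strictly between `i` and `j`, so deleting a third index `l` lowers both or neither.
-- This carries the induction of `det-adjacent` to the minors.
adjacent-punchOut : ∀ {n} {i j l : Fin (suc n)} → Adjacent i j →
  (l≢i : l ≢ i) (l≢j : l ≢ j) → Adjacent (punchOut l≢i) (punchOut l≢j)
adjacent-punchOut {l = zero}        here        l≢i l≢j = contradiction ≡.refl l≢i
adjacent-punchOut {l = zero}        (there i∼j) l≢i l≢j = i∼j
adjacent-punchOut {l = suc zero}    here        l≢i l≢j = contradiction ≡.refl l≢j
adjacent-punchOut {suc (suc n)} {l = suc (suc l)} here l≢i l≢j = here
adjacent-punchOut {suc n} {l = suc l} (there i∼j) l≢i l≢j =
  there (adjacent-punchOut i∼j (l≢i ∘ ≡.cong suc) (l≢j ∘ ≡.cong suc))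

-- mix s f g agrees with f up to index s and with g beyond.
mix : ∀ {a} {A : Set a} → ℕ → (ℕ → A) → (ℕ → A) → ℕ → A
mix s       f g zero    = f zero
mix zero    f g (suc l) = g (suc l)
mix (suc s) f g (suc l) = mix s (f ∘ suc) (g ∘ suc) l

module _ {a} {A : Set a} where

  mix-≤ : ∀ {s l} (f g : ℕ → A) → l ≤ s → mix s f g l ≡ f l
  mix-≤ f g z≤n       = ≡.refl
  mix-≤ f g (s≤s l≤s) = mix-≤ (f ∘ suc) (g ∘ suc) l≤s

  mix-suc : ∀ s (f g : ℕ → A) → mix s f g (suc s) ≡ g (suc s)
  mix-suc zero    f g = ≡.refl
  mix-suc (suc s) f g = mix-suc s (f ∘ suc) (g ∘ suc)

  mix-≢ : ∀ s {l} (f g : ℕ → A) → l ≢ suc s → mix s f g l ≡ mix (suc s) f g l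
  mix-≢ s       {zero}        f g l≢1+s = ≡.refl
  mix-≢ zero    {suc zero}    f g l≢1+s = contradiction ≡.refl l≢1+s
  mix-≢ zero    {suc (suc l)} f g l≢1+s = ≡.refl
  mix-≢ (suc s) {suc l}       f g l≢1+s =
    mix-≢ s (f ∘ suc) (g ∘ suc) (l≢1+s ∘ ≡.cong suc)

module Determinant {c ℓ} (R : CommutativeRing c ℓ) where
  open CommutativeRing R renaming (zero to *-zero; _+_ to _⊕_)
  open CommutativeRingDefs R
  open SemiringSolver commutativeSemiring using (solve; _:+_; _:*_; _:=_; con)
  open RingProperties ring using (-‿distribˡ-*; x[y-z]≈xy-xz)
  open CommutativeMonoidSum +-commutativeMonoid
    using (∑-distrib-+) renaming (sum-replicate-zero to ∑-0)
  open CommutativeMonoidSum *-commutativeMonoid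
    using ()
    renaming (∑-distrib-+ to ∏-distrib-*; sum-remove to ∏-remove; sum-replicate to ∏-const)
  private
    module + = CommutativeMonoidSum +-commutativeMonoid
    module * = CommutativeMonoidSum *-commutativeMonoid
  open SemiringSum semiring using (*-distribˡ-sum)
  open Exp semiring using (^-homo-*)
  open SetoidReasoning setoid

  -- Finite sums and products

  ∏-cong : ∀ {n} (f g : Vector Carrier n) → (∀ i → f i ≈ g i) → ∏ f ≈ ∏ g
  ∏-cong f g f≈g = *.sum-cong-≋ f≈g

  ∑-cong : ∀ {n} (f g : Vector Carrier n) → (∀ i → f i ≈ g i) → ∑ f ≈ ∑ g
  ∑-cong f g f≈g = +.sum-cong-≋ f≈g

  ∑-zero : ∀ {n} {f : Vector Carrier n} → (∀ i → f i ≈ 0#) → ∑ f ≈ 0#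
  ∑-zero {n} {f} f≈0 = trans (∑-cong f (λ _ → 0#) f≈0) (∑-0 n)

  ∑-adjacent : ∀ {n} {i j : Fin n} {f} → Adjacent i j → f i ⊕ f j ≈ 0# →
    (∀ l → l ≢ i → l ≢ j → f l ≈ 0#) → ∑ f ≈ 0#
  ∑-adjacent {f = f} here fᵢ+fⱼ≈0 f≈0 = begin
    f zero ⊕ (f (suc zero) ⊕ ∑ (tail (tail f)))  ≈⟨ +-assoc _ _ _ ⟨
    f zero ⊕ f (suc zero) ⊕ ∑ (tail (tail f))
      ≈⟨ +-cong fᵢ+fⱼ≈0 (∑-zero λ l → f≈0 (suc (suc l)) (λ ()) (λ ())) ⟩
    0# ⊕ 0#                                      ≈⟨ +-identityˡ 0# ⟩
    0#                                           ∎
  ∑-adjacent (there i∼j) fᵢ+fⱼ≈0 f≈0 = trans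
    (+-cong (f≈0 zero (λ ()) (λ ()))
      (∑-adjacent i∼j fᵢ+fⱼ≈0 λ l l≢i l≢j →
        f≈0 (suc l) (λ { ≡.refl → l≢i ≡.refl }) (λ { ≡.refl → l≢j ≡.refl })))
    (+-identityˡ 0#)

  -- The two vectors can differ only at the position of `i`, where one holds `v j` and the other
  -- `v i`. Hence two equal adjacent columns have equal minors in the Laplace expansion.
  removeAt-adjacent : ∀ {n} {i j : Fin (suc n)} (v : Vector Carrier (suc n)) →
    Adjacent i j → v i ≈ v j → ∀ l → removeAt v i l ≈ removeAt v j l
  removeAt-adjacent v here        e zero    = sym e
  removeAt-adjacent v here        e (suc l) = refl
  removeAt-adjacent {suc n} v (there i∼j) e zero    = refl
  removeAt-adjacent {suc n} v (there i∼j) e (suc l) = removeAt-adjacent (tail v) i∼j e l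

  -- Laplace expansion: linearity and alternation in the columns

  minor : ∀ {n} → Matrix (suc n) → Fin (suc n) → Matrix n
  minor M j i = removeAt (M (suc i)) j

  laplaceTerm : ∀ {n} → Matrix (suc n) → Fin (suc n) → Carrier
  laplaceTerm M j = (- 1#) ^ toℕ j * M zero j * det (minor M j)

  det-cong : ∀ {n} {M N : Matrix n} → (∀ i j → M i j ≈ N i j) → det M ≈ det N
  det-cong {zero}  M≈N = refl
  det-cong {suc n} {M} {N} M≈N = ∑-cong (laplaceTerm M) (laplaceTerm N) λ j →
    *-cong (*-congˡ {(- 1#) ^ toℕ j} (M≈N zero j)) (det-cong λ i l → M≈N (suc i) (punchIn j l))

  -- In the Laplace term of column `j` the entry is the linear combination and the minor does not
  -- see column `j`. In every other term the entry is unchanged and the minor is linear by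
  -- induction.
  det-linear : ∀ {n} {M U V : Matrix n} (j : Fin n) {x y} →
    (∀ i l → l ≢ j → M i l ≈ U i l) → (∀ i l → l ≢ j → M i l ≈ V i l) →
    (∀ i → M i j ≈ x * U i j ⊕ y * V i j) → det M ≈ x * det U ⊕ y * det V
  det-linear {suc n} {M} {U} {V} j {x} {y} M≈U M≈V Mⱼ≈ = begin
    det M
      ≈⟨ ∑-cong (laplaceTerm M) (λ l → x * laplaceTerm U l ⊕ y * laplaceTerm V l) term ⟩
    ∑ (λ l → x * laplaceTerm U l ⊕ y * laplaceTerm V l)
      ≈⟨ ∑-distrib-+ (λ l → x * laplaceTerm U l) (λ l → y * laplaceTerm V l) ⟩
    ∑ (λ l → x * laplaceTerm U l) ⊕ ∑ (λ l → y * laplaceTerm V l)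
      ≈⟨ +-cong (*-distribˡ-sum x (laplaceTerm U)) (*-distribˡ-sum y (laplaceTerm V)) ⟨
    x * det U ⊕ y * det V ∎
    where
    s : Fin (suc n) → Carrier
    s l = (- 1#) ^ toℕ l

    term : ∀ l → laplaceTerm M l ≈ x * laplaceTerm U l ⊕ y * laplaceTerm V l
    term l with l ≟ j
    ... | yes ≡.refl = begin
      s l * M zero l * det (minor M l)
        ≈⟨ *-congʳ (*-congˡ (Mⱼ≈ zero)) ⟩
      s l * (x * U zero l ⊕ y * V zero l) * det (minor M l)
        ≈⟨ solve 6 (λ s x u y v m → s :* (x :* u :+ y :* v) :* m
             := x :* (s :* u :* m) :+ y :* (s :* v :* m)) refl _ _ _ _ _ _ ⟩
      x * (s l * U zero l * det (minor M l)) ⊕ y * (s l * V zero l * det (minor M l))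
        ≈⟨ +-cong (*-congˡ (*-congˡ (det-cong λ i m → M≈U _ _ (punchInᵢ≢i l m))))
             (*-congˡ (*-congˡ (det-cong λ i m → M≈V _ _ (punchInᵢ≢i l m)))) ⟩
      x * (s l * U zero l * det (minor U l)) ⊕ y * (s l * V zero l * det (minor V l)) ∎
    ... | no l≢j = begin
      s l * M zero l * det (minor M l)
        ≈⟨ *-congˡ (det-linear (punchOut l≢j)
             (λ i m m≢ → M≈U _ _ (m≢ ∘ unpunch)) (λ i m m≢ → M≈V _ _ (m≢ ∘ unpunch))
             λ i → ≡.subst (λ k → M (suc i) k ≈ x * U (suc i) k ⊕ y * V (suc i) k)
               (≡.sym (punchIn-punchOut l≢j)) (Mⱼ≈ (suc i))) ⟩
      s l * M zero l * (x * det (minor U l) ⊕ y * det (minor V l))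
        ≈⟨ solve 6 (λ s m x u y v → s :* m :* (x :* u :+ y :* v)
             := x :* (s :* m :* u) :+ y :* (s :* m :* v)) refl _ _ _ _ _ _ ⟩
      x * (s l * M zero l * det (minor U l)) ⊕ y * (s l * M zero l * det (minor V l))
        ≈⟨ +-cong (*-congˡ (*-congʳ (*-congˡ (M≈U zero l l≢j))))
             (*-congˡ (*-congʳ (*-congˡ (M≈V zero l l≢j)))) ⟩
      x * (s l * U zero l * det (minor U l)) ⊕ y * (s l * V zero l * det (minor V l)) ∎
      where
      unpunch : ∀ {m} → punchIn l m ≡ j → m ≡ punchOut l≢j
      unpunch e = punchIn-injective l _ _ (≡.trans e (≡.sym (punchIn-punchOut l≢j)))

  -- The terms of columns `i` and `j` have equal entries, equal minors and opposite signs. Every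
  -- other minor still contains two equal adjacent columns and vanishes by induction.
  det-adjacent : ∀ {n} {M : Matrix n} {i j} → Adjacent i j →
    (∀ r → M r i ≈ M r j) → det M ≈ 0#
  det-adjacent {suc n} {M} {i} {j} i∼j Mᵢ≈Mⱼ = ∑-adjacent i∼j cancel vanish
    where
    cancel : laplaceTerm M i ⊕ laplaceTerm M j ≈ 0#
    cancel = begin
      (- 1#) ^ toℕ i * M zero i * det (minor M i)
        ⊕ (- 1#) ^ toℕ j * M zero j * det (minor M j)
        ≡⟨ ≡.cong (λ k → (- 1#) ^ toℕ i * M zero i * det (minor M i)
             ⊕ (- 1#) ^ k * M zero j * det (minor M j)) (toℕ-adjacent i∼j) ⟩
      (- 1#) ^ toℕ i * M zero i * det (minor M i)
        ⊕ - 1# * (- 1#) ^ toℕ i * M zero j * det (minor M j)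
        ≈⟨ +-cong (*-cong (*-congˡ (Mᵢ≈Mⱼ zero))
             (det-cong λ r → removeAt-adjacent (M (suc r)) i∼j (Mᵢ≈Mⱼ (suc r)))) refl ⟩
      (- 1#) ^ toℕ i * M zero j * det (minor M j)
        ⊕ - 1# * (- 1#) ^ toℕ i * M zero j * det (minor M j)
        ≈⟨ solve 4 (λ n s m d → s :* m :* d :+ n :* s :* m :* d
             := (con 1 :+ n) :* (s :* m :* d)) refl _ _ _ _ ⟩
      (1# ⊕ - 1#) * ((- 1#) ^ toℕ i * M zero j * det (minor M j))
        ≈⟨ *-congʳ (-‿inverseʳ 1#) ⟩
      0# * ((- 1#) ^ toℕ i * M zero j * det (minor M j))
        ≈⟨ zeroˡ _ ⟩
      0# ∎

    vanish : ∀ l → l ≢ i → l ≢ j → laplaceTerm M l ≈ 0#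
    vanish l l≢i l≢j = trans
      (*-congˡ (det-adjacent (adjacent-punchOut i∼j l≢i l≢j) λ r →
        trans (reflexive (≡.cong (M (suc r)) (punchIn-punchOut l≢i)))
          (trans (Mᵢ≈Mⱼ (suc r)) (reflexive (≡.cong (M (suc r)) (≡.sym (punchIn-punchOut l≢j)))))))
      (zeroʳ _)

  -- Column operations and scaling

  -- Linearity in column `j` splits off `y * det V`, where `V` is `M` with column `j` overwritten by
  -- column `i`; its two equal adjacent columns make it vanish.
  det-columnOperation : ∀ {n} {M N : Matrix n} {i j : Fin n} {x y} → Adjacent i j →
    (∀ r l → l ≢ j → N r l ≈ M r l) → (∀ r → N r j ≈ x * M r j ⊕ y * M r i) →
    det N ≈ x * det M
  det-columnOperation {n} {M} {N} {i} {j} {x} {y} i∼j N≈M Nⱼ≈ = begin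
    det N                ≈⟨ det-linear j N≈M (λ r l l≢j → trans (N≈M r l l≢j) (sym (V≈M r l l≢j)))
                              (λ r → trans (Nⱼ≈ r) (+-congˡ (*-congˡ (sym (Vⱼ≈Mᵢ r))))) ⟩
    x * det M ⊕ y * det V ≈⟨ +-congˡ (*-congˡ (det-adjacent i∼j λ r →
                              trans (V≈M r i (adjacent-≢ i∼j)) (sym (Vⱼ≈Mᵢ r)))) ⟩
    x * det M ⊕ y * 0#    ≈⟨ +-congˡ (zeroʳ y) ⟩
    x * det M ⊕ 0#        ≈⟨ +-identityʳ _ ⟩
    x * det M             ∎
    where
    V : Matrix n
    V r = updateAt (M r) j (const (M r i))

    V≈M : ∀ r l → l ≢ j → V r l ≈ M r l
    V≈M r l l≢j = reflexive (updateAt-minimal l j (M r) l≢j)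

    Vⱼ≈Mᵢ : ∀ r → V r j ≈ M r i
    Vⱼ≈Mᵢ r = reflexive (updateAt-updates j (M r))

  -- The operations are applied from the last column backwards, so that each
  -- one still sees the original left neighbour.
  det-columnOperations : ∀ {m} (f g : Fin (suc m) → ℕ → Carrier) (x y : ℕ → Carrier) →
    (∀ r → g r 0 ≈ f r 0) →
    (∀ r t → suc t ≤ m → g r (suc t) ≈ x t * f r (suc t) ⊕ y t * f r t) →
    det (λ r l → g r (toℕ l)) ≈ ∏ {m} (x ∘ toℕ) * det (λ r l → f r (toℕ l))
  det-columnOperations {m} f g x y g₀≈ gₛ≈ = begin
    det (λ r l → g r (toℕ l))               ≈⟨ det-cong (λ r l → mix-0 r (toℕ l)) ⟨
    det (stage 0)                           ≈⟨ go m 0 ≡.refl ⟩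
    ∏ {m} (x ∘ toℕ) * det (λ r l → f r (toℕ l)) ∎
    where
    -- In `stage 0` every column is transformed, because `g` and `f` share column 0; in `stage m`
    -- none is. Stages `s` and `suc s` differ only in column `suc s`.
    stage : ℕ → Matrix (suc m)
    stage s r l = mix s (f r) (g r) (toℕ l)

    mix-0 : ∀ r l → mix 0 (f r) (g r) l ≈ g r l
    mix-0 r zero    = sym (g₀≈ r)
    mix-0 r (suc l) = refl

    step : ∀ s → suc s ≤ m → det (stage s) ≈ x s * det (stage (suc s))
    step s s<m = det-columnOperation {i = i} {j}
      (adjacent i j (≡.trans toℕj (≡.cong suc (≡.sym toℕi))))
      (λ r l l≢j → reflexive (mix-≢ s (f r) (g r)
        λ e → l≢j (toℕ-injective (≡.trans e (≡.sym toℕj)))))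
      λ r → begin
        mix s (f r) (g r) (toℕ j)    ≡⟨ ≡.trans (≡.cong (mix s (f r) (g r)) toℕj)
                                          (mix-suc s (f r) (g r)) ⟩
        g r (suc s)                  ≈⟨ gₛ≈ r s s<m ⟩
        x s * f r (suc s) ⊕ y s * f r s
          ≡⟨ ≡.cong₂ (λ u v → x s * u ⊕ y s * v)
               (≡.trans (≡.cong (mix (suc s) (f r) (g r)) toℕj) (mix-≤ (f r) (g r) (ℕ.≤-refl {suc s})))
               (≡.trans (≡.cong (mix (suc s) (f r) (g r)) toℕi) (mix-≤ (f r) (g r) (ℕ.n≤1+n s))) ⟨
        x s * stage (suc s) r j ⊕ y s * stage (suc s) r i ∎
      where
      i j : Fin (suc m)
      i = fromℕ< (s≤s (ℕ.≤-trans (ℕ.n≤1+n s) s<m))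
      j = fromℕ< (s≤s s<m)

      toℕi : toℕ i ≡ s
      toℕi = toℕ-fromℕ< _

      toℕj : toℕ j ≡ suc s
      toℕj = toℕ-fromℕ< (s≤s s<m)

    -- Here `r` counts the operations still to be undone, those on columns `suc s` to `m`.
    go : ∀ r s → s + r ≡ m →
      det (stage s) ≈ ∏ {r} (λ t → x (s + toℕ t)) * det (λ r l → f r (toℕ l))
    go zero s e = trans
      (det-cong λ r l → reflexive (mix-≤ (f r) (g r)
        (ℕ.≤-trans (toℕ≤pred[n] l) (ℕ.≤-reflexive (≡.trans (≡.sym e) (ℕ.+-identityʳ s))))))
      (sym (*-identityˡ _))
    go (suc r) s e = begin
      det (stage s)
        ≈⟨ step s (≡.subst (suc s ≤_) (≡.trans (≡.sym (ℕ.+-suc s r)) e) (s≤s (ℕ.m≤m+n s r))) ⟩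
      x s * det (stage (suc s))
        ≈⟨ *-congˡ (go r (suc s) (≡.trans (≡.sym (ℕ.+-suc s r)) e)) ⟩
      x s * (∏ {r} (λ t → x (suc s + toℕ t)) * det (λ r l → f r (toℕ l)))
        ≈⟨ *-assoc _ _ _ ⟨
      x s * ∏ {r} (λ t → x (suc s + toℕ t)) * det (λ r l → f r (toℕ l))
        ≈⟨ *-congʳ (*-cong (reflexive (≡.cong x (ℕ.+-identityʳ s)))
             (∏-cong {r} (λ t → x (s + suc (toℕ t))) (λ t → x (suc s + toℕ t)) λ t →
               reflexive (≡.cong x (ℕ.+-suc s (toℕ t))))) ⟨
      ∏ {suc r} (λ t → x (s + toℕ t)) * det (λ r l → f r (toℕ l)) ∎

  private
    factor : ∀ s x m p d → s * (x * m) * (p * d) ≈ x * p * (s * m * d)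
    factor = solve 5 (λ s x m p d → s :* (x :* m) :* (p :* d) := x :* p :* (s :* m :* d)) refl

  det-scaleRows : ∀ {n} (x : Fin n → Carrier) (M : Matrix n) →
    det (λ i j → x i * M i j) ≈ ∏ x * det M
  det-scaleRows {zero}  x M = sym (*-identityˡ 1#)
  det-scaleRows {suc n} x M = begin
    det (λ i j → x i * M i j)
      ≈⟨ ∑-cong (laplaceTerm λ i j → x i * M i j) (λ j → ∏ x * laplaceTerm M j) (λ j → begin
        (- 1#) ^ toℕ j * (x zero * M zero j) * det (λ i l → x (suc i) * minor M j i l)
          ≈⟨ *-congˡ (det-scaleRows (tail x) (minor M j)) ⟩
        (- 1#) ^ toℕ j * (x zero * M zero j) * (∏ (tail x) * det (minor M j))
          ≈⟨ factor _ _ _ _ _ ⟩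
        ∏ x * laplaceTerm M j ∎) ⟩
    ∑ (λ j → ∏ x * laplaceTerm M j)
      ≈⟨ *-distribˡ-sum (∏ x) (laplaceTerm M) ⟨
    ∏ x * det M ∎

  det-scaleColumns : ∀ {n} (x : Fin n → Carrier) (M : Matrix n) →
    det (λ i j → x j * M i j) ≈ ∏ x * det M
  det-scaleColumns {zero}  x M = sym (*-identityˡ 1#)
  det-scaleColumns {suc n} x M = begin
    det (λ i j → x j * M i j)
      ≈⟨ ∑-cong (laplaceTerm λ i j → x j * M i j) (λ j → ∏ x * laplaceTerm M j) (λ j → begin
        (- 1#) ^ toℕ j * (x j * M zero j) * det (λ i l → removeAt x j l * minor M j i l)
          ≈⟨ *-congˡ (det-scaleColumns (removeAt x j) (minor M j)) ⟩
        (- 1#) ^ toℕ j * (x j * M zero j) * (∏ (removeAt x j) * det (minor M j))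
          ≈⟨ factor _ _ _ _ _ ⟩
        x j * ∏ (removeAt x j) * laplaceTerm M j
          ≈⟨ *-congʳ (∏-remove {i = j} x) ⟨
        ∏ x * laplaceTerm M j ∎) ⟩
    ∑ (λ j → ∏ x * laplaceTerm M j)
      ≈⟨ *-distribˡ-sum (∏ x) (laplaceTerm M) ⟨
    ∏ x * det M ∎

  det-firstRow : ∀ {n} (M : Matrix (suc n)) → (∀ j → M zero (suc j) ≈ 0#) →
    det M ≈ M zero zero * det (λ i j → M (suc i) (suc j))
  det-firstRow M M₀≈0 = trans
    (+-cong (*-congʳ (*-identityˡ _))
      (∑-zero λ j → trans (*-congʳ (trans (*-congˡ (M₀≈0 j)) (zeroʳ _))) (zeroˡ _)))
    (+-identityʳ _)

  -- Pair products, hybrid products and the exchange identity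

  -- The pairs `(zero , zero)` and `(suc i , zero)` contribute literal factors `1#`, which the two
  -- uses of `*-identityˡ` remove.
  ∏<-suc : ∀ {n} (f : Fin (suc n) → Fin (suc n) → Carrier) →
    ∏< f ≈ ∏ (λ j → f zero (suc j)) * ∏< (λ i j → f (suc i) (suc j))
  ∏<-suc f = *-cong (*-identityˡ _) (∏-cong
    (λ i → 1# * ∏ λ j → if does (i <? j) then f (suc i) (suc j) else 1#)
    (λ i → ∏ λ j → if does (i <? j) then f (suc i) (suc j) else 1#)
    λ i → *-identityˡ _)

  -- The product of u t over t < j and v t over j ≤ t < m; only meaningful for j ≤ m.
  hybrid : ℕ → ℕ → (ℕ → Carrier) → (ℕ → Carrier) → Carrier
  hybrid m       zero    u v = ∏ {m} (v ∘ toℕ)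
  hybrid zero    (suc j) u v = 1#
  hybrid (suc m) (suc j) u v = u 0 * hybrid m j (u ∘ suc) (v ∘ suc)

  -- The hybrids for `j` and `suc j` differ only in the factor of index `j`. Pulling it out here and
  -- in `hybrid-u` leaves the same product, so a combination of neighbouring columns has a common
  -- factor.
  hybrid-v : ∀ {m j} (u v : ℕ → Carrier) → j ≤ m →
    hybrid (suc m) j u v ≈ v j * hybrid m j u (v ∘ suc)
  hybrid-v u v z≤n       = refl
  hybrid-v u v (s≤s j≤m) = trans (*-congˡ (hybrid-v (u ∘ suc) (v ∘ suc) j≤m))
    (solve 3 (λ x y z → x :* (y :* z) := y :* (x :* z)) refl _ _ _)

  hybrid-u : ∀ {m j} (u v : ℕ → Carrier) → j ≤ m →
    hybrid (suc m) (suc j) u v ≈ u j * hybrid m j u (v ∘ suc)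
  hybrid-u u v z≤n       = refl
  hybrid-u u v (s≤s j≤m) = trans (*-congˡ (hybrid-u (u ∘ suc) (v ∘ suc) j≤m))
    (solve 3 (λ x y z → x :* (y :* z) := y :* (x :* z)) refl _ _ _)

  -- Both sides consist of all `v t` with `t < m` and all `u t` with `t < j`. This is a
  -- division-free form of trading the first `j` factors of `v` for those of `u`.
  ∏*hybrid : ∀ {m j} (u v : ℕ → Carrier) → j ≤ m →
    ∏ {j} (u ∘ toℕ) * ∏ {m} (v ∘ toℕ) ≈ ∏ {j} (v ∘ toℕ) * hybrid m j u v
  ∏*hybrid u v z≤n = refl
  ∏*hybrid {suc m} {suc j} u v (s≤s j≤m) = begin
    u 0 * U * (v 0 * ∏ {m} (v ∘ suc ∘ toℕ))
      ≈⟨ solve 4 (λ a b c d → a :* b :* (c :* d) := c :* a :* (b :* d)) refl _ _ _ _ ⟩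
    v 0 * u 0 * (U * ∏ {m} (v ∘ suc ∘ toℕ))
      ≈⟨ *-congˡ (∏*hybrid (u ∘ suc) (v ∘ suc) j≤m) ⟩
    v 0 * u 0 * (V * hybrid m j (u ∘ suc) (v ∘ suc))
      ≈⟨ solve 4 (λ a b c d → a :* b :* (c :* d) := a :* c :* (b :* d)) refl _ _ _ _ ⟩
    v 0 * V * (u 0 * hybrid m j (u ∘ suc) (v ∘ suc)) ∎
    where
    U V : Carrier
    U = ∏ {j} (u ∘ suc ∘ toℕ)
    V = ∏ {j} (v ∘ suc ∘ toℕ)

  -- The terms `1#` and `a * b * x * y` occur in both products and cancel; the remaining four terms
  -- factor. This produces the row factor and the column factor in `det-hybrid`.
  exchange : ∀ a b x y →
    (1# - b * y) * (1# - a * x) - (1# - a * y) * (1# - b * x) ≈ (y - x) * (a - b)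
  exchange a b x y = begin
    (1# - b * y) * (1# - a * x) - W
      ≈⟨ +-congʳ (begin
        (1# - b * y) * (1# - a * x)
          ≈⟨ *-cong (+-congˡ (-‿distribˡ-* b y)) (+-congˡ (-‿distribˡ-* a x)) ⟩
        (1# ⊕ - b * y) * (1# ⊕ - a * x)
          ≈⟨ solve 4 (λ a′ b′ x y → (con 1 :+ b′ :* y) :* (con 1 :+ a′ :* x)
               := con 1 :+ b′ :* y :+ a′ :* x :+ a′ :* b′ :* x :* y) refl _ _ _ _ ⟩
        1# ⊕ - b * y ⊕ - a * x ⊕ - a * - b * x * y
          ≈⟨ +-congʳ (+-congˡ (trans (sym (-‿distribˡ-* a x))
               (trans (-‿cong (*-comm a x)) (-‿distribˡ-* x a)))) ⟩
        1# ⊕ - b * y ⊕ - x * a ⊕ - a * - b * x * y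
          -- The semiring solver sees `- a`, `- b` and `- x` as independent variables, so the
          -- cancelling pairs needed for the factored form are added by hand as a zero.
          ≈⟨ trans (+-cong (trans (*-congʳ (-‿inverseʳ a)) (zeroˡ y))
               (trans (*-congʳ (-‿inverseʳ x)) (zeroˡ (- b)))) (+-identityʳ 0#) ⟨+0 ⟩
        1# ⊕ - b * y ⊕ - x * a ⊕ - a * - b * x * y ⊕ ((a - a) * y ⊕ (x - x) * - b)
          ≈⟨ solve 6 (λ a a′ b′ x x′ y →
               con 1 :+ b′ :* y :+ x′ :* a :+ a′ :* b′ :* x :* y
                 :+ ((a :+ a′) :* y :+ (x :+ x′) :* b′)
               := (y :+ x′) :* (a :+ b′) :+ (con 1 :+ a′ :* y) :* (con 1 :+ b′ :* x))
               refl _ _ _ _ _ _ ⟩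
        (y - x) * (a - b) ⊕ (1# ⊕ - a * y) * (1# ⊕ - b * x)
          ≈⟨ +-congˡ (*-cong (+-congˡ (-‿distribˡ-* a y)) (+-congˡ (-‿distribˡ-* b x))) ⟨
        (y - x) * (a - b) ⊕ W ∎) ⟩
    (y - x) * (a - b) ⊕ W - W
      ≈⟨ +-assoc _ _ _ ⟩
    (y - x) * (a - b) ⊕ (W - W)
      ≈⟨ +-congˡ (-‿inverseʳ W) ⟩
    (y - x) * (a - b) ⊕ 0#
      ≈⟨ +-identityʳ _ ⟩
    (y - x) * (a - b) ∎
    where
    W : Carrier
    W = (1# - a * y) * (1# - b * x)

    _⟨+0 : ∀ {x y} → y ≈ 0# → x ≈ x ⊕ y
    e ⟨+0 = trans (sym (+-identityʳ _)) (+-congˡ (sym e))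

  -- Evaluation of the hybrid determinant

  -- Stated as cancellation because the induction of `det-hybrid` only strikes a common factor from
  -- both sides of an equation.
  Cancellable : Carrier → Set (c ⊔ ℓ)
  Cancellable x = ∀ y z → x * y ≈ x * z → y ≈ z

  ∏-cancellable : ∀ {n} (f : Vector Carrier n) → (∀ i → Cancellable (f i)) → Cancellable (∏ f)
  ∏-cancellable {zero}  f canc y z e = trans (sym (*-identityˡ y)) (trans e (*-identityˡ z))
  ∏-cancellable {suc n} f canc y z e = ∏-cancellable (tail f) (canc ∘ suc) y z
    (canc zero _ _ (trans (sym (*-assoc _ _ _)) (trans e (*-assoc _ _ _))))

  -- The product of A t - B s over t ≤ s < m.
  differences : ℕ → (ℕ → Carrier) → (ℕ → Carrier) → Carrier
  differences zero    A B = 1#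
  differences (suc m) A B = ∏ {suc m} (λ t → A (toℕ t) - B (toℕ t)) * differences m A (B ∘ suc)

  det-hybrid : ∀ m (A B : ℕ → Carrier) (x : Fin (suc m) → Carrier) →
    (∀ i t → Cancellable (1# - B t * x i)) →
    det {suc m} (λ i j → hybrid m (toℕ j) (λ t → 1# - A t * x i) (λ t → 1# - B t * x i))
      ≈ ∏< (λ i j → x i - x j) * differences m A B
  det-hybrid zero    A B x canc = trans (+-identityʳ _) (sym (*-identityʳ _))
  det-hybrid (suc m) A B x canc = ∏-cancellable {suc m} (v zero ∘ toℕ) (λ t → canc zero (toℕ t)) _ _
    (begin
    V * det (λ i j → f i (toℕ j))
      ≈⟨ det-columnOperations f g (v zero) (λ t → - u zero t) (λ _ → refl) columnOperation ⟨
    det (λ i j → g i (toℕ j))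
      -- The corner entry `g zero 0` is a hybrid with no `u` factors, which is `V` by definition;
      -- this is the factor that `∏-cancellable` removes.
      ≈⟨ det-firstRow (λ i j → g i (toℕ j))
           (λ j → trans (*-congʳ (-‿inverseʳ (x zero))) (zeroˡ _)) ⟩
    V * det (λ i j → row i * (column j * N i j))
      ≈⟨ *-congˡ (trans (det-scaleRows row (λ i j → column j * N i j))
           (*-congˡ (det-scaleColumns column N))) ⟩
    V * (∏ row * (∏ column * det N))
      ≈⟨ *-congˡ (*-congˡ (*-congˡ (det-hybrid m A (B ∘ suc) (x ∘ suc)
           λ i t → canc (suc i) (suc t)))) ⟩
    V * (∏ row * (∏ column * (∏< (λ i j → x (suc i) - x (suc j)) * differences m A (B ∘ suc))))
      -- The row factors are the pairs that involve row `zero` and complete `∏<`; the column factors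
      -- complete `differences (suc m) A B`.
      ≈⟨ *-congˡ (trans (solve 4 (λ r c d t → r :* (c :* (d :* t)) := r :* d :* (c :* t))
             refl _ _ _ _)
           (*-congʳ (sym (∏<-suc (λ i j → x i - x j))))) ⟩
    V * (∏< (λ i j → x i - x j) * differences (suc m) A B) ∎)
    where
    u v : Fin (suc (suc m)) → ℕ → Carrier
    u i t = 1# - A t * x i
    v i t = 1# - B t * x i

    f g : Fin (suc (suc m)) → ℕ → Carrier
    f i l = hybrid (suc m) l (u i) (v i)
    g i zero    = f i zero
    g i (suc l) = (x zero - x i) * ((A l - B l) * hybrid m l (u i) (v i ∘ suc))

    V : Carrier
    V = ∏ {suc m} (v zero ∘ toℕ)

    row column : Fin (suc m) → Carrier
    row i    = x zero - x (suc i)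
    column j = A (toℕ j) - B (toℕ j)

    N : Matrix (suc m)
    N i j = hybrid m (toℕ j) (u (suc i)) (v (suc i) ∘ suc)

    columnOperation : ∀ i t → suc t ≤ suc m →
      g i (suc t) ≈ v zero t * f i (suc t) ⊕ - u zero t * f i t
    columnOperation i t (s≤s t≤m) = sym (begin
      v zero t * f i (suc t) ⊕ - u zero t * f i t
        ≈⟨ +-cong (*-congˡ (hybrid-u (u i) (v i) t≤m)) (*-congˡ (hybrid-v (u i) (v i) t≤m)) ⟩
      v zero t * (u i t * h) ⊕ - u zero t * (v i t * h)
        ≈⟨ solve 5 (λ a b c d h → a :* (b :* h) :+ c :* (d :* h)
             := (a :* b :+ c :* d) :* h) refl _ _ _ _ _ ⟩
      (v zero t * u i t ⊕ - u zero t * v i t) * h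
        ≈⟨ *-congʳ (trans (+-congˡ (sym (-‿distribˡ-* (u zero t) (v i t))))
             (exchange (A t) (B t) (x i) (x zero))) ⟩
      (x zero - x i) * (A t - B t) * h
        ≈⟨ *-assoc _ _ _ ⟩
      g i (suc t) ∎)
      where
      h : Carrier
      h = hybrid m t (u i) (v i ∘ suc)

  -- q-shifted factorials and the closed form of the differences

  ⟨⨾⟩-suc : ∀ x q m → ⟨ x ⨾ q ⟩ (suc m) ≈ (1# - x) * ⟨ x * q ⨾ q ⟩ m
  ⟨⨾⟩-suc x q m = *-cong (+-congˡ (-‿cong (*-identityʳ x)))
    (∏-cong {m} (λ k → 1# - x * q ^ suc (toℕ k)) (λ k → 1# - x * q * q ^ toℕ k)
      λ k → +-congˡ (-‿cong (sym (*-assoc x q (q ^ toℕ k)))))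

  -- The power `q ^ k` is kept as the last factor so that each new term has the shape `1# - A t * y`
  -- with `y = q ^ k`, as `det-hybrid` requires.
  ⟨⨾⟩-+ : ∀ x q k m → ⟨ x ⨾ q ⟩ (k + m) ≈ ⟨ x ⨾ q ⟩ k * ∏ {m} (λ t → 1# - x * q ^ toℕ t * q ^ k)
  ⟨⨾⟩-+ x q zero    m = sym (trans (*-identityˡ _)
    (∏-cong {m} (λ t → 1# - x * q ^ toℕ t * 1#) (λ t → 1# - x * q ^ toℕ t)
      λ t → +-congˡ (-‿cong (*-identityʳ _))))
  ⟨⨾⟩-+ x q (suc k) m = begin
    ⟨ x ⨾ q ⟩ (suc k + m)
      ≈⟨ ⟨⨾⟩-suc x q (k + m) ⟩
    (1# - x) * ⟨ x * q ⨾ q ⟩ (k + m)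
      ≈⟨ *-congˡ (⟨⨾⟩-+ (x * q) q k m) ⟩
    (1# - x) * (⟨ x * q ⨾ q ⟩ k * ∏ {m} (λ t → 1# - x * q * q ^ toℕ t * q ^ k))
      ≈⟨ *-assoc _ _ _ ⟨
    (1# - x) * ⟨ x * q ⨾ q ⟩ k * ∏ {m} (λ t → 1# - x * q * q ^ toℕ t * q ^ k)
      ≈⟨ *-cong (sym (⟨⨾⟩-suc x q k))
           (∏-cong {m} (λ t → 1# - x * q * q ^ toℕ t * q ^ k) (λ t → 1# - x * q ^ toℕ t * q ^ suc k)
             λ t → +-congˡ (-‿cong (solve 4 (λ x q y z → x :* q :* y :* z := x :* y :* (q :* z))
               refl _ _ _ _))) ⟩
    ⟨ x ⨾ q ⟩ suc k * ∏ {m} (λ t → 1# - x * q ^ toℕ t * q ^ suc k) ∎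

  -- Each of the `n` factorials of positive length starts with the factor `1# - x`.
  ∏⟨⨾⟩-suc : ∀ x q n →
    ∏ {suc n} (λ i → ⟨ x ⨾ q ⟩ toℕ i) ≈ (1# - x) ^ n * ∏ {n} (λ i → ⟨ x * q ⨾ q ⟩ toℕ i)
  ∏⟨⨾⟩-suc x q n = begin
    1# * ∏ {n} (λ i → ⟨ x ⨾ q ⟩ suc (toℕ i))
      ≈⟨ trans (*-identityˡ _) (∏-cong {n} (λ i → ⟨ x ⨾ q ⟩ suc (toℕ i))
           (λ i → (1# - x) * ⟨ x * q ⨾ q ⟩ toℕ i) λ i → ⟨⨾⟩-suc x q (toℕ i)) ⟩
    ∏ {n} (λ i → (1# - x) * ⟨ x * q ⨾ q ⟩ toℕ i)
      ≈⟨ ∏-distrib-* {n} (λ _ → 1# - x) (λ i → ⟨ x * q ⨾ q ⟩ toℕ i) ⟩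
    ∏ {n} (λ _ → 1# - x) * ∏ {n} (λ i → ⟨ x * q ⨾ q ⟩ toℕ i)
      ≈⟨ *-congʳ (∏-const n) ⟩
    (1# - x) ^ n * ∏ {n} (λ i → ⟨ x * q ⨾ q ⟩ toℕ i) ∎

  ^-C-2 : ∀ x n → x ^ n * x ^ (n C 2) ≈ x ^ (suc n C 2)
  ^-C-2 x n = trans (sym (^-homo-* x n (n C 2))) (reflexive (≡.cong (x ^_)
    (≡.trans (≡.cong (_+ n C 2) (≡.sym (nC1≡n n))) (nCk+nC[k+1]≡[n+1]C[k+1] n 1))))

  ^-C-3 : ∀ x n → x ^ (n C 2) * x ^ (n C 3) ≈ x ^ (suc n C 3)
  ^-C-3 x n = trans (sym (^-homo-* x (n C 2) (n C 3)))
    (reflexive (≡.cong (x ^_) (nCk+nC[k+1]≡[n+1]C[k+1] n 2)))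

  ∏-powers : ∀ x n → ∏ {n} (λ t → x ^ suc (toℕ t)) ≈ x ^ (suc n C 2)
  ∏-powers x zero    = refl
  ∏-powers x (suc n) = begin
    x * 1# * ∏ {n} (λ t → x * x ^ suc (toℕ t))
      ≈⟨ *-cong (*-identityʳ x) (∏-distrib-* {n} (λ _ → x) (λ t → x ^ suc (toℕ t))) ⟩
    x * (∏ {n} (λ _ → x) * ∏ {n} (λ t → x ^ suc (toℕ t)))
      ≈⟨ *-congˡ (*-cong (∏-const n) (∏-powers x n)) ⟩
    x * (x ^ n * x ^ (suc n C 2))
      ≈⟨ *-assoc _ _ _ ⟨
    x ^ suc n * x ^ (suc n C 2)
      ≈⟨ ^-C-2 x (suc n) ⟩
    x ^ (suc (suc n) C 2) ∎

  differences-cong : ∀ m {A B B′ : ℕ → Carrier} → (∀ t → B t ≈ B′ t) →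
    differences m A B ≈ differences m A B′
  differences-cong zero    B≈B′ = refl
  differences-cong (suc m) {A} {B} {B′} B≈B′ = *-cong
    (∏-cong {suc m} (λ t → A (toℕ t) - B (toℕ t)) (λ t → A (toℕ t) - B′ (toℕ t))
      λ t → +-congˡ (-‿cong (B≈B′ (toℕ t))))
    (differences-cong m (B≈B′ ∘ suc))

  module _ (a q : Carrier) where

    ∏-differences : ∀ b n → ∏ {n} (λ t → a * q * q ^ toℕ t - a * b * q ^ 2 * q ^ toℕ t)
      ≈ a ^ n * q ^ (suc n C 2) * (1# - b * q) ^ n
    ∏-differences b n = begin
      ∏ {n} (λ t → a * q * q ^ toℕ t - a * b * q ^ 2 * q ^ toℕ t)
        ≈⟨ ∏-cong {n} _ (λ t → a * q ^ suc (toℕ t) * (1# - b * q)) term ⟩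
      ∏ {n} (λ t → a * q ^ suc (toℕ t) * (1# - b * q))
        ≈⟨ ∏-distrib-* {n} (λ t → a * q ^ suc (toℕ t)) (λ _ → 1# - b * q) ⟩
      ∏ {n} (λ t → a * q ^ suc (toℕ t)) * ∏ {n} (λ _ → 1# - b * q)
        ≈⟨ *-cong (∏-distrib-* {n} (λ _ → a) (λ t → q ^ suc (toℕ t))) (∏-const n) ⟩
      ∏ {n} (λ _ → a) * ∏ {n} (λ t → q ^ suc (toℕ t)) * (1# - b * q) ^ n
        ≈⟨ *-congʳ (*-cong (∏-const n) (∏-powers q n)) ⟩
      a ^ n * q ^ (suc n C 2) * (1# - b * q) ^ n ∎
      where
      term : (t : Fin n) → a * q * q ^ toℕ t - a * b * q ^ 2 * q ^ toℕ t
        ≈ a * q ^ suc (toℕ t) * (1# - b * q)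
      term t = sym (trans (x[y-z]≈xy-xz _ _ _) (+-cong
        (trans (*-identityʳ _) (sym (*-assoc _ _ _)))
        (-‿cong (solve 4 (λ a b q y → a :* (q :* y) :* (b :* q)
          := a :* b :* (q :* (q :* con 1)) :* y) refl _ _ _ _))))

    -- Shifting the second sequence by one index replaces `b` by `b * q`, so the induction lets `b`
    -- vary. The exponents add up by Pascal's rule, and `∏⟨⨾⟩-suc` absorbs the power of
    -- `1# - b * q`.
    differences-geometric : ∀ m b →
      differences m (λ t → a * q * q ^ t) (λ t → a * b * q ^ 2 * q ^ t)
        ≈ a ^ (suc m C 2) * q ^ (suc (suc m) C 3) * ∏ {suc m} (λ i → ⟨ b * q ⨾ q ⟩ toℕ i)
    differences-geometric zero    b = sym (trans (*-cong (*-identityʳ _) (*-identityʳ _)) (*-identityʳ _))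
    differences-geometric (suc m) b = begin
      ∏ {suc m} (λ t → a * q * q ^ toℕ t - a * b * q ^ 2 * q ^ toℕ t)
        * differences m (λ t → a * q * q ^ t) (λ t → a * b * q ^ 2 * q ^ suc t)
        ≈⟨ *-cong (∏-differences b (suc m)) (trans
             (differences-cong m λ t →
               solve 4 (λ a b q y → a :* b :* (q :* (q :* con 1)) :* (q :* y)
                 := a :* (b :* q) :* (q :* (q :* con 1)) :* y) refl _ _ _ _)
             (differences-geometric m (b * q))) ⟩
      a ^ suc m * q ^ (suc (suc m) C 2) * (1# - b * q) ^ suc m
        * (a ^ (suc m C 2) * q ^ (suc (suc m) C 3) * ∏ {suc m} (λ i → ⟨ b * q * q ⨾ q ⟩ toℕ i))
        ≈⟨ solve 6 (λ a q b a′ q′ b′ → a :* q :* b :* (a′ :* q′ :* b′)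
             := a :* a′ :* (q :* q′) :* (b :* b′)) refl _ _ _ _ _ _ ⟩
      a ^ suc m * a ^ (suc m C 2) * (q ^ (suc (suc m) C 2) * q ^ (suc (suc m) C 3))
        * ((1# - b * q) ^ suc m * ∏ {suc m} (λ i → ⟨ b * q * q ⨾ q ⟩ toℕ i))
        ≈⟨ *-cong (*-cong (^-C-2 a (suc m)) (^-C-3 q (suc (suc m))))
             (sym (∏⟨⨾⟩-suc (b * q) q (suc m))) ⟩
      a ^ (suc (suc m) C 2) * q ^ (suc (suc (suc m)) C 3)
        * ∏ {suc (suc m)} (λ i → ⟨ b * q ⨾ q ⟩ toℕ i) ∎

  -- Determinants of ratios of q-shifted factorials

  unit⇒cancellable : ∀ {x x⁻¹} → x * x⁻¹ ≈ 1# → Cancellable x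
  unit⇒cancellable {x} {x⁻¹} e y z xy≈xz = begin
    y               ≈⟨ *-identityˡ y ⟨
    1# * y          ≈⟨ *-congʳ e ⟨
    x * x⁻¹ * y     ≈⟨ solve 3 (λ x x⁻¹ y → x :* x⁻¹ :* y := x⁻¹ :* (x :* y)) refl _ _ _ ⟩
    x⁻¹ * (x * y)   ≈⟨ *-congˡ xy≈xz ⟩
    x⁻¹ * (x * z)   ≈⟨ solve 3 (λ x x⁻¹ y → x :* x⁻¹ :* y := x⁻¹ :* (x :* y)) refl _ _ _ ⟨
    x * x⁻¹ * z     ≈⟨ *-congʳ e ⟩
    1# * z          ≈⟨ *-identityˡ z ⟩
    z               ∎

  module _ (a b q : Carrier) (d : ℕ → Carrier)
           (d-inverse : ∀ m → ⟨ a * b * q ^ 2 ⨾ q ⟩ m * d m ≈ 1#) where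

    private
      N D : ℕ → Carrier
      N m = ⟨ a * q ⨾ q ⟩ m
      D m = ⟨ a * b * q ^ 2 ⨾ q ⟩ m

      u v : ℕ → ℕ → Carrier
      u k t = 1# - a * q * q ^ t * q ^ k
      v k t = 1# - a * b * q ^ 2 * q ^ t * q ^ k

    -- The factor `v k t` is the last one of `D (t + k + 1)`, which is invertible; the product of
    -- the other factors and `d (t + k + 1)` is therefore its inverse.
    v-cancellable : ∀ k t → Cancellable (v k t)
    v-cancellable k t = unit⇒cancellable (begin
      v k t * (D (t + k) * d (t + k + 1))
        ≈⟨ *-assoc _ _ _ ⟨
      v k t * D (t + k) * d (t + k + 1)
        ≈⟨ *-congʳ (trans (*-comm _ _) (*-congˡ (trans (+-congˡ (-‿cong (begin
             a * b * q ^ 2 * q ^ t * q ^ k  ≈⟨ *-assoc _ _ _ ⟩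
             a * b * q ^ 2 * (q ^ t * q ^ k) ≈⟨ *-cong (sym (*-identityʳ _)) (sym (^-homo-* q t k)) ⟩
             a * b * q ^ 2 * q ^ 0 * q ^ (t + k) ∎)))
             (sym (*-identityʳ _))))) ⟩
      D (t + k) * ∏ {1} (λ s → 1# - a * b * q ^ 2 * q ^ toℕ s * q ^ (t + k)) * d (t + k + 1)
        ≈⟨ *-congʳ (⟨⨾⟩-+ (a * b * q ^ 2) q (t + k) 1) ⟨
      D (t + k + 1) * d (t + k + 1)
        ≈⟨ d-inverse (t + k + 1) ⟩
      1# ∎)

    -- Beyond `N k`, the numerator has the factors `u k t` with `t < j`; enlarging the denominator
    -- from `D (k + j)` to `D (k + m)` is repaid by the factors `v k t` with `j ≤ t < m`.
    ratio-hybrid : ∀ k {m j} → j ≤ m →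
      N (k + j) * d (k + j) ≈ N k * d (k + m) * hybrid m j (u k) (v k)
    ratio-hybrid k {m} {j} j≤m = begin
      N (k + j) * d (k + j)
        ≈⟨ trans (*-congˡ (d-inverse (k + m))) (*-identityʳ _) ⟨
      N (k + j) * d (k + j) * (D (k + m) * d (k + m))
        ≈⟨ solve 4 (λ n d D e → n :* d :* (D :* e) := n :* D :* (d :* e)) refl _ _ _ _ ⟩
      N (k + j) * D (k + m) * (d (k + j) * d (k + m))
        ≈⟨ *-congʳ (*-cong (⟨⨾⟩-+ (a * q) q k j) (⟨⨾⟩-+ (a * b * q ^ 2) q k m)) ⟩
      N k * U * (D k * V) * (d (k + j) * d (k + m))
        ≈⟨ solve 6 (λ n U D V d e → n :* U :* (D :* V) :* (d :* e)
             := n :* e :* d :* D :* (U :* V)) refl _ _ _ _ _ _ ⟩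
      N k * d (k + m) * d (k + j) * D k * (U * V)
        ≈⟨ *-congˡ (∏*hybrid (u k) (v k) j≤m) ⟩
      N k * d (k + m) * d (k + j) * D k * (V′ * h)
        ≈⟨ solve 6 (λ n e d D V h → n :* e :* d :* D :* (V :* h)
             := n :* e :* h :* (D :* V :* d)) refl _ _ _ _ _ _ ⟩
      -- The product `D k * V′` reassembles `D (k + j)`, which `d (k + j)` inverts.
      N k * d (k + m) * h * (D k * V′ * d (k + j))
        ≈⟨ *-congˡ (trans (*-congʳ (sym (⟨⨾⟩-+ (a * b * q ^ 2) q k j))) (d-inverse (k + j))) ⟩
      N k * d (k + m) * h * 1#
        ≈⟨ *-identityʳ _ ⟩
      N k * d (k + m) * h ∎
      where
      U V V′ h : Carrier
      U  = ∏ {j} (u k ∘ toℕ)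
      V  = ∏ {m} (v k ∘ toℕ)
      V′ = ∏ {j} (v k ∘ toℕ)
      h  = hybrid m j (u k) (v k)

    det-ratio : ∀ m (k : Fin (suc m) → ℕ) →
      det (λ i j → N (k i + toℕ j) * d (k i + toℕ j))
        ≈ a ^ (suc m C 2) * q ^ (suc (suc m) C 3)
          * ∏ (λ i → N (k i) * d (k i + m))
          * ∏< (λ i j → q ^ k i - q ^ k j)
          * ∏ {suc m} (λ i → ⟨ b * q ⨾ q ⟩ toℕ i)
    det-ratio m k = begin
      det (λ i j → N (k i + toℕ j) * d (k i + toℕ j))
        ≈⟨ det-cong (λ i j → ratio-hybrid (k i) (toℕ≤pred[n] j)) ⟩
      det (λ i j → r i * H i j)
        ≈⟨ det-scaleRows r H ⟩
      ∏ r * det H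
        ≈⟨ *-congˡ (det-hybrid m (λ t → a * q * q ^ t) (λ t → a * b * q ^ 2 * q ^ t)
             (λ i → q ^ k i) λ i → v-cancellable (k i)) ⟩
      ∏ r * (∏< (λ i j → q ^ k i - q ^ k j)
        * differences m (λ t → a * q * q ^ t) (λ t → a * b * q ^ 2 * q ^ t))
        ≈⟨ *-congˡ (*-congˡ (differences-geometric a q m b)) ⟩
      ∏ r * (∏< (λ i j → q ^ k i - q ^ k j) * (a ^ (suc m C 2) * q ^ (suc (suc m) C 3)
        * ∏ {suc m} (λ i → ⟨ b * q ⨾ q ⟩ toℕ i)))
        ≈⟨ solve 4 (λ r d c p → r :* (d :* (c :* p)) := c :* r :* d :* p) refl _ _ _ _ ⟩
      a ^ (suc m C 2) * q ^ (suc (suc m) C 3) * ∏ r * ∏< (λ i j → q ^ k i - q ^ k j)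
        * ∏ {suc m} (λ i → ⟨ b * q ⨾ q ⟩ toℕ i) ∎
      where
      r : Fin (suc m) → Carrier
      r i = N (k i) * d (k i + m)

      H : Matrix (suc m)
      H i j = hybrid m (toℕ j) (u (k i)) (v (k i))

-- Nonvanishing of the denominators by evaluation at the origin

module ConstantTerm {c ℓ} (R : CommutativeRing c ℓ) where
  open CommutativeRing R using (_≈_; _*_; 0#; sym; trans; zeroˡ; +-identityʳ)
  open Polynomial R using (Poly; _*ₚ_; _·_; coeff; coeff-+; coeff-·)

  coeff₀-* : ∀ p r → coeff (p *ₚ r) 0 ≈ coeff p 0 * coeff r 0
  coeff₀-* []      r = sym (zeroˡ _)
  coeff₀-* (x ∷ p) r = trans (coeff-+ (x · r) (0# ∷ p *ₚ r) 0) (trans (+-identityʳ _) (coeff-· x r 0))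

open import Defs

private
  module R₁ = IntegralDomain ℚ[a]
  module R₂ = IntegralDomain ℚ[a,b]
  module R₃ = IntegralDomain ℚ[a,b,q]
  module P₁ = Polynomial (IntegralDomain.commutativeRing ℚ-domain)
  module P₂ = Polynomial R₁.commutativeRing
  module P₃ = Polynomial R₂.commutativeRing
  module C₁ = ConstantTerm (IntegralDomain.commutativeRing ℚ-domain)
  module C₂ = ConstantTerm R₁.commutativeRing
  module C₃ = ConstantTerm R₂.commutativeRing
  module F = Fractions ℚ[a,b,q]
  module K = CommutativeRing ℚ⟨a,b,q⟩

-- Evaluation at a = b = q = 0.
ε : R₃.Carrier → ℚ
ε p = P₁.coeff (P₂.coeff (P₃.coeff p 0) 0) 0

ε-cong : ∀ {p r} → p R₃.≈ r → ε p ≡ ε r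
ε-cong e = P₁.coeff≈ (P₂.coeff≈ (P₃.coeff≈ e 0) 0) 0

ε-* : ∀ p r → ε (p R₃.* r) ≡ ε p ℚ.* ε r
ε-* p r = ≡.trans (P₁.coeff≈ (P₂.coeff≈ (C₃.coeff₀-* p r) 0) 0)
  (≡.trans (P₁.coeff≈ (C₂.coeff₀-* (P₃.coeff p 0) (P₃.coeff r 0)) 0)
    (C₁.coeff₀-* (P₂.coeff (P₃.coeff p 0) 0) (P₂.coeff (P₃.coeff r 0) 0)))

ε-+ : ∀ p r → ε (p R₃.+ r) ≡ ε p ℚ.+ ε r
ε-+ p r = ≡.trans (P₁.coeff≈ (P₂.coeff≈ (P₃.coeff-+ p r 0) 0) 0)
  (≡.trans (P₁.coeff≈ (P₂.coeff-+ (P₃.coeff p 0) (P₃.coeff r 0) 0) 0)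
    (P₁.coeff-+ (P₂.coeff (P₃.coeff p 0) 0) (P₂.coeff (P₃.coeff r 0) 0) 0))

ε-neg : ∀ p → ε (R₃.- p) ≡ ℚ.- ε p
ε-neg p = ≡.trans (P₁.coeff≈ (P₂.coeff≈ (P₃.coeff-neg p 0) 0) 0)
  (≡.trans (P₁.coeff≈ (P₂.coeff-neg (P₃.coeff p 0) 0) 0)
    (P₁.coeff-neg (P₂.coeff (P₃.coeff p 0) 0) 0))

-- The fraction x takes the value e at a = b = q = 0, with denominator normalised to 1 there.
record HasValue (x : Carrier) (e : ℚ) : Set where
  constructor hasValue
  field
    ε-num : ε (F.num x) ≡ e
    ε-den : ε (F.den x) ≡ 1ℚ

hasValue-* : ∀ {x y e f} → HasValue x e → HasValue y f → HasValue (x * y) (e ℚ.* f)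
hasValue-* {x} {y} (hasValue nx dx) (hasValue ny dy) = hasValue
  (≡.trans (ε-* (F.num x) (F.num y)) (≡.cong₂ ℚ._*_ nx ny))
  (≡.trans (ε-* (F.den x) (F.den y)) (≡.cong₂ ℚ._*_ dx dy))

hasValue-1- : ∀ {x} → HasValue x 0ℚ → HasValue (K.1# - x) 1ℚ
hasValue-1- {x} (hasValue nx dx) = hasValue
  (≡.trans (ε-+ (R₃.1# R₃.* F.den x) (R₃.- F.num x R₃.* R₃.1#)) (≡.cong₂ ℚ._+_
    (≡.trans (ε-* R₃.1# (F.den x)) (≡.cong (1ℚ ℚ.*_) dx))
    (≡.trans (ε-* (R₃.- F.num x) R₃.1#)
      (≡.cong (ℚ._* 1ℚ) (≡.trans (ε-neg (F.num x)) (≡.cong ℚ.-_ nx))))))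
  (≡.trans (ε-* R₃.1# (F.den x)) (≡.cong (1ℚ ℚ.*_) dx))

-- The value is left existential, since these powers are only ever multiplied by something of value
-- 0.
hasValue-^ : ∀ {x e} → HasValue x e → ∀ n → ∃ (HasValue (x ^ n))
hasValue-^ x↦e zero    = 1ℚ , hasValue ≡.refl ≡.refl
hasValue-^ x↦e (suc n) = _ , hasValue-* x↦e (proj₂ (hasValue-^ x↦e n))

hasValue-∏ : ∀ {n} (f : Fin n → Carrier) → (∀ i → HasValue (f i) 1ℚ) → HasValue (∏ f) 1ℚ
hasValue-∏ {zero}  f f↦1 = hasValue ≡.refl ≡.refl
hasValue-∏ {suc n} f f↦1 = hasValue-* (f↦1 zero) (hasValue-∏ (tail f) (f↦1 ∘ suc))

-- Equality with zero is a cross-multiplied identity of polynomials; applying `ε` to it would give 1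
-- = 0 in the rationals.
hasValue-1⇒≉0 : ∀ {x} → HasValue x 1ℚ → ¬ x ≈ K.0#
hasValue-1⇒≉0 {x} (hasValue nx dx) x≈0 = ℚ.1≢0 (begin
  1ℚ                         ≡⟨ nx ⟨
  ε (F.num x)                ≡⟨ ℚ.*-identityʳ _ ⟨
  ε (F.num x) ℚ.* 1ℚ         ≡⟨ ε-* (F.num x) R₃.1# ⟨
  ε (F.num x R₃.* R₃.1#)     ≡⟨ ε-cong (F.cross≈ x≈0) ⟩
  ε (R₃.0# R₃.* F.den x)     ≡⟨⟩
  0ℚ                         ∎)
  where open ≡.≡-Reasoning

-- Every factor is 1 minus a multiple of `a`. With `hasValue-1⇒≉0` this makes the total inverse in
-- `μ` a genuine one.
denominator-hasValue-1 : ∀ m → HasValue (⟨ a * b * q ^ 2 ⨾ q ⟩ m) 1ℚ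
denominator-hasValue-1 m = hasValue-∏ {m} (λ i → K.1# - a * b * q ^ 2 * q ^ toℕ i) λ i →
  -- The value of `a * b * q ^ 2` computes to `0ℚ`; only the power with variable exponent `toℕ i`
  -- calls for `ℚ.*-zeroˡ`.
  hasValue-1- (≡.subst (HasValue (a * b * q ^ 2 * q ^ toℕ i))
      (ℚ.*-zeroˡ (proj₁ (hasValue-^ q↦0 (toℕ i))))
    (hasValue-* (hasValue-* (hasValue-* a↦0 b↦0) (proj₂ (hasValue-^ q↦0 2)))
      (proj₂ (hasValue-^ q↦0 (toℕ i)))))
  where
  a↦0 : HasValue a 0ℚ
  a↦0 = hasValue ≡.refl ≡.refl

  b↦0 : HasValue b 0ℚ
  b↦0 = hasValue ≡.refl ≡.refl

  q↦0 : HasValue q 0ℚ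
  q↦0 = hasValue ≡.refl ≡.refl

theorem1p3 : ∀ (n : ℕ) .{{_ : NonZero n}} (k : Fin n → ℕ) →
    det (λ (i j : Fin n) → μ (k i + toℕ j))
    ≈ a ^ (n C 2) * q ^ (suc n C 3)
    * ∏ (λ (i : Fin n) → ⟨ a * q ⨾ q ⟩ (k i) / ⟨ a * b * q ^ 2 ⨾ q ⟩ (k i + pred n))
    * ∏< (λ (i j : Fin n) → q ^ k i - q ^ k j)
    * ∏ (λ (i : Fin n) → ⟨ b * q ⨾ q ⟩ (toℕ i))
-- With `n = suc m`, `pred n` reduces to `m` and `/` unfolds to multiplication by `F.⁻¹`, so the
-- general identity applies as it stands.
theorem1p3 (suc m) k = Determinant.det-ratio ℚ⟨a,b,q⟩ a b q
  (λ l → ⟨ a * b * q ^ 2 ⨾ q ⟩ l F.⁻¹)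
  (λ l → F.*-inverseʳ (⟨ a * b * q ^ 2 ⨾ q ⟩ l) (hasValue-1⇒≉0 (denominator-hasValue-1 l)))
  m k
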